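{- For every positive integer $d$ there exists a positive integer $m$ such that every sequence $(a_1,\dotsc,a_m)$ of $m$ distinct real numbers contains a monotone subsequence whose index set is a proper affine $d$-cube; that is, there is a proper affine $d$-cube $S\subseteq[m]$ such that the subsequence $(a_i)_{i\in S}$ (taken in increasing order of indices) is monotone.
   Context: An affine $d$-cube is a set of integers of the form $\{x_0+\varepsilon_1 x_1+\dotsb+\varepsilon_d x_d : \varepsilon_1,\dotsc,\varepsilon_d\in\{0,1\}\}$ for some integers $x_0,x_1,\dotsc,x_d$. It is proper if it contains $2^d$ distinct elements. $[m]=\{1,\dotsc,m\}$. -}

module Defs where

open import Level using (0ℓ)
open import Data.Nat using (ℕ; zero; suc)
open import Data.Integer using (ℤ; +_; _+_; _≤_; _<_)
open import Data.Fin using (Fin; zero; suc)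
open import Data.Bool using (Bool; true; false)
open import Data.Product using (_×_)
open import Relation.Binary.PropositionalEquality using (_≡_)
open import Relation.Binary.Bundles using (StrictTotalOrder)

bit : Bool → ℤ
bit false = + 0
bit true  = + 1

sumFin : ∀ {d} → (Fin d → ℤ) → ℤ
sumFin {zero}  f = + 0
sumFin {suc d} f = f zero + sumFin (λ i → f (suc i))

cubeElem : ∀ {d} → ℤ → (Fin d → ℤ) → (Fin d → Bool) → ℤ
cubeElem x₀ x ε = x₀ + sumFin (λ i → bit (ε i) Data.Integer.* x i)

ProperCube : ∀ {d} → ℤ → (Fin d → ℤ) → Set
ProperCube x₀ x = ∀ ε ε′ → cubeElem x₀ x ε ≡ cubeElem x₀ x ε′ → ∀ i → ε i ≡ ε′ i

CubeIn : ℕ → ∀ {d} → ℤ → (Fin d → ℤ) → Set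
CubeIn m x₀ x = ∀ ε → (+ 1 ≤ cubeElem x₀ x ε) × (cubeElem x₀ x ε ≤ + m)

module _ (O : StrictTotalOrder 0ℓ 0ℓ 0ℓ) where
  open StrictTotalOrder O renaming (Carrier to A; _<_ to _<ₒ_)

  -- a sequence (a_1,…,a_m) of distinct elements, given as a : ℤ → A
  -- (only the values at indices 1,…,m are relevant)
  DistinctOn : ℕ → (ℤ → A) → Set
  DistinctOn m a = ∀ i j → + 1 ≤ i → i ≤ + m → + 1 ≤ j → j ≤ + m → a i ≈ a j → i ≡ j

  IncreasingOn : ∀ {d} → (ℤ → A) → ℤ → (Fin d → ℤ) → Set
  IncreasingOn a x₀ x = ∀ ε ε′ → cubeElem x₀ x ε < cubeElem x₀ x ε′
    → a (cubeElem x₀ x ε) <ₒ a (cubeElem x₀ x ε′)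

  DecreasingOn : ∀ {d} → (ℤ → A) → ℤ → (Fin d → ℤ) → Set
  DecreasingOn a x₀ x = ∀ ε ε′ → cubeElem x₀ x ε < cubeElem x₀ x ε′
    → a (cubeElem x₀ x ε′) <ₒ a (cubeElem x₀ x ε)

{-# OPTIONS --safe #-}
module Submission where

-- In a long sequence one finds, by Ramsey arguments in the spirit of Fishburn and Graham, a
-- "grid" of indices X₁(c₁) + … + X_m(c_m) whose values are ordered lexicographically for some order
-- of significance of the coordinates. Grids grow one coordinate at a time: among many order
-- isomorphic blocks, each containing the same grid, the choice of the block is a new coordinate,
-- which dominates all others in the index and is inserted somewhere in the order of significance.
--
-- Listing the coordinates by significance for values, Ramsey's theorem gives a long sublist along
-- which the significance for indices decreases or increases. In the first case both orders agree.
-- In the second case x₁ ≪ x₂ ≪ … ≪ x_{2d} the generators x_i + x_{2d+1-i} make them agree: their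
-- order by value is decided by the first summand and their order by index by the second one.
-- The direction of the order may depend on the node of the lexicographic tree; a Hilbert cube
-- argument (merging consecutive coordinates) makes it constant on every level.

open import Defs
open import Level using (0ℓ)
open import Data.Nat using (ℕ; zero; suc; _+_; _*_; _∸_; _^_; _≤_; _<_; z≤n; s≤s; z<s)
open import Data.Nat.Properties
open import Data.Nat.Tactic.RingSolver using (solve-∀)
open import Data.Bool using (Bool; true; false; if_then_else_)
open import Data.Empty using (⊥-elim)
import Data.Integer as ℤ
open import Data.Integer using (ℤ)
import Data.Integer.Properties as ℤ
import Data.Fin as Fin
open import Data.Fin using (Fin; zero; suc; toℕ; combine; inject≤; fromℕ<; funToFin; finToFun)
import Data.Fin.Properties as Fin
open import Data.Fin.Properties
  using (pigeonhole; toℕ<n; toℕ-fromℕ<; toℕ-combine; toℕ-inject≤; combine-injective; finToFun-funToFin)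
open import Data.Vec using (Vec; []; _∷_; _++_; _∷ʳ_; map; zipWith; replicate; splitAt; initLast; sum; lookup; tabulate; insertAt)
open import Data.Vec.Properties using (∷ʳ-injective; map-∷ʳ; lookup-map; lookup-replicate; lookup∘tabulate)
open import Data.Vec.Relation.Unary.All using (All; []; _∷_)
import Data.Vec.Relation.Unary.All as All
import Data.Vec.Relation.Unary.All.Properties as All
open import Data.Vec.Relation.Unary.AllPairs using (AllPairs; []; _∷_)
open import Data.Product using (Σ; ∃; ∃₂; _×_; _,_; proj₁; proj₂; swap)
open import Data.Sum using (_⊎_; inj₁; inj₂; [_,_]′) renaming (map to ⊎-map; swap to ⊎-swap)
open import Function using (_∘_; id)
open import Relation.Nullary using (Dec; yes; no)
open import Relation.Binary.Bundles using (StrictTotalOrder)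
open import Relation.Binary.Consequences using (tri⇒dec<)
open import Relation.Binary.Definitions using (Transitive; Trichotomous; tri<; tri≈; tri>)
open import Relation.Binary.PropositionalEquality

private
  variable
    A B C : Set
    k m n d N : ℕ

-- Ramsey theory on Fin

-- Increasing injections from `Fin k` to `Fin n` as lists of decisions. `none` discards all that
-- remains, so that a search may stop once enough elements are found.
data Thin : ℕ → ℕ → Set where
  none : Thin 0 n
  take : Thin k n → Thin (suc k) (suc n)
  skip : Thin k n → Thin k (suc n)

at : Thin k n → Fin k → Fin n
at (take θ) zero = zero
at (take θ) (suc i) = suc (at θ i)
at (skip θ) i = suc (at θ i)

at-mono : (θ : Thin k n) {i j : Fin k} → i Fin.< j → at θ i Fin.< at θ j
at-mono (take θ) {zero} {suc j} _ = z<s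
at-mono (take θ) {suc i} {suc j} (s≤s lt) = s≤s (at-mono θ lt)
at-mono (skip θ) lt = s≤s (at-mono θ lt)

thin-∘ : Thin k m → Thin m n → Thin k n
thin-∘ none _ = none
thin-∘ (take θ) (take φ) = take (thin-∘ θ φ)
thin-∘ (skip θ) (take φ) = skip (thin-∘ θ φ)
thin-∘ θ@(take _) (skip φ) = skip (thin-∘ θ φ)
thin-∘ θ@(skip _) (skip φ) = skip (thin-∘ θ φ)

at-∘ : (θ : Thin k m) (φ : Thin m n) (i : Fin k) → at (thin-∘ θ φ) i ≡ at φ (at θ i)
at-∘ (take θ) (take φ) zero = refl
at-∘ (take θ) (take φ) (suc i) = cong suc (at-∘ θ φ i)
at-∘ (skip θ) (take φ) i = cong suc (at-∘ θ φ i)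
at-∘ θ@(take _) (skip φ) i = cong suc (at-∘ θ φ i)
at-∘ θ@(skip _) (skip φ) i = cong suc (at-∘ θ φ i)

select : ∀ p q → p + q ≤ n → {P Q : Fin n → Set} → (∀ i → P i ⊎ Q i) →
         (∃ λ (θ : Thin p n) → ∀ i → P (at θ i)) ⊎ (∃ λ (θ : Thin q n) → ∀ i → Q (at θ i))
select zero q _ c = inj₁ (none , λ ())
select (suc p) zero _ c = inj₂ (none , λ ())
select (suc p) (suc q) (s≤s le) c with c zero
... | inj₁ h = ⊎-map (λ (θ , k) → take θ , λ { zero → h ; (suc i) → k i }) (λ (θ , k) → skip θ , k)
                 (select p (suc q) le (c ∘ suc))
... | inj₂ h = ⊎-map (λ (θ , k) → skip θ , k) (λ (θ , k) → take θ , λ { zero → h ; (suc i) → k i })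
                 (select (suc p) q (≤-trans (≤-reflexive (sym (+-suc p q))) le) (c ∘ suc))

-- Induction on the number of colours: `select` yields either enough points of colour zero or enough
-- points that avoid it.
pigeonholes : ∀ c k → ∃ λ n → (f : Fin n → Fin c) → ∃₂ λ (θ : Thin k n) j → ∀ i → f (at θ i) ≡ j
-- With no colours at all, a single point is already contradictory.
pigeonholes zero k = 1 , λ f → ⊥-elim (Fin.¬Fin0 (f zero))
pigeonholes (suc c) k with pigeonholes c k
... | n , ih = k + n , λ f → [ (λ (θ , h) → θ , zero , h) , rest f ]′ (select k n ≤-refl (λ i → zero? (f i)))
  where
  zero? : (x : Fin (suc c)) → x ≡ zero ⊎ ∃ λ y → x ≡ suc y
  zero? zero = inj₁ refl
  zero? (suc y) = inj₂ (y , refl)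
  rest : ∀ f → (∃ λ (θ : Thin n (k + n)) → ∀ i → ∃ λ y → f (at θ i) ≡ suc y) →
         ∃₂ λ (θ : Thin k (k + n)) j → ∀ i → f (at θ i) ≡ j
  rest f (θ , h) with ih (λ i → proj₁ (h i))
  ... | φ , j , h′ = thin-∘ φ θ , suc j , λ i →
        trans (cong f (at-∘ φ θ i)) (trans (proj₂ (h (at φ i))) (cong suc (h′ i)))

Clique : (Fin n → Fin n → Set) → ℕ → Set
Clique {n} P k = ∃ λ (θ : Thin k n) → ∀ {i j} → i Fin.< j → P (at θ i) (at θ j)

clique-∘ : {P : Fin n → Fin n → Set} (θ : Thin m n) → Clique (λ i j → P (at θ i) (at θ j)) k → Clique P k
clique-∘ {P = P} θ (φ , h) = thin-∘ φ θ , λ lt → subst₂ P (sym (at-∘ φ θ _)) (sym (at-∘ φ θ _)) (h lt)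

clique-suc : {P : Fin (suc n) → Fin (suc n) → Set} → Clique (λ i j → P (suc i) (suc j)) k → Clique P k
clique-suc (θ , h) = skip θ , h

clique-cons : {P : Fin (suc n) → Fin (suc n) → Set} (θ : Thin m n) → (∀ i → P zero (suc (at θ i))) →
              Clique (λ i j → P (suc (at θ i)) (suc (at θ j))) k → Clique P (suc k)
clique-cons {P = P} θ h (φ , h′) = take (thin-∘ φ θ) , λ
  { {zero} {suc j} _ → subst (λ x → P zero (suc x)) (sym (at-∘ φ θ j)) (h (at φ j))
  ; {suc i} {suc j} (s≤s lt) → subst₂ (λ x y → P (suc x) (suc y)) (sym (at-∘ φ θ i)) (sym (at-∘ φ θ j)) (h′ lt) }

-- The recursion of Erdős and Szekeres: the first vertex splits the others into two classes, one of
-- which is large enough for induction. Colours are arbitrary relations covering all pairs, so a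
-- clique delivers the wanted facts directly.
ramsey : ∀ p q → ∃ λ n → ∀ {P Q : Fin n → Fin n → Set} → (∀ {i j} → i Fin.< j → P i j ⊎ Q i j) → Clique P p ⊎ Clique Q q
ramsey zero q = 0 , λ _ → inj₁ (none , λ { {()} })
ramsey (suc p) zero = 0 , λ _ → inj₂ (none , λ { {()} })
ramsey (suc p) (suc q) with ramsey p (suc q) | ramsey (suc p) q
... | a , ramsey-a | b , ramsey-b = suc (a + b) , λ {P} {Q} c →
  [ (λ (θ , h) → ⊎-map (clique-cons {P = P} θ h) (clique-suc {P = Q} ∘ clique-∘ {P = λ i j → Q (suc i) (suc j)} θ)
                   (ramsey-a {P = λ i j → P (suc (at θ i)) (suc (at θ j))} {Q = λ i j → Q (suc (at θ i)) (suc (at θ j))}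
                     (λ lt → c (s≤s (at-mono θ lt)))))
  , (λ (θ , h) → ⊎-map (clique-suc {P = P} ∘ clique-∘ {P = λ i j → P (suc i) (suc j)} θ) (clique-cons {P = Q} θ h)
                   (ramsey-b {P = λ i j → P (suc (at θ i)) (suc (at θ j))} {Q = λ i j → Q (suc (at θ i)) (suc (at θ j))}
                     (λ lt → c (s≤s (at-mono θ lt))))) ]′
  (select a b ≤-refl {P = λ i → P zero (suc i)} {Q = λ i → Q zero (suc i)} (λ i → c z<s))

-- The colourings are treated one after the other, each time passing to a `Q`-clique; the first
-- `P`-clique found ends the process. Hence `P` holds for one `g` only, but `Q` for all.
ramsey-family : ∀ n q r → ∃ λ s → ∀ {P Q : Fin q → Fin s → Fin s → Set} →
  (∀ g {i j} → i Fin.< j → P g i j ⊎ Q g i j) →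
  (∃ λ g → Clique (P g) n) ⊎ Clique (λ i j → ∀ g → Q g i j) r
ramsey-family n zero r = r , λ _ → inj₂ (full r , λ _ ())
  where
  full : ∀ r → Thin r r
  full zero = none
  full (suc r) = take (full r)
ramsey-family n (suc q) r with ramsey-family n q r
... | s , ih with ramsey n s
... | s′ , first = s′ , λ {P} {Q} c → [ (λ p → inj₁ (zero , p)) , rest {P} {Q} c ]′ (first (c zero))
  where
  rest : ∀ {P Q} → (∀ g {i j} → i Fin.< j → P g i j ⊎ Q g i j) → Clique (Q zero) s →
         (∃ λ g → Clique (P g) n) ⊎ Clique (λ i j → ∀ g → Q g i j) r
  rest {P} {Q} c (θ , h) = ⊎-map
    (λ (g , p) → suc g , clique-∘ {P = P (suc g)} θ p)
    (λ (φ , h′) → thin-∘ φ θ , λ lt g →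
      subst₂ (Q g) (sym (at-∘ φ θ _)) (sym (at-∘ φ θ _)) (both φ h′ lt g))
    (ih (λ g lt → c (suc g) (at-mono θ lt)))
    where
    both : ∀ (φ : Thin r s) → (∀ {i j} → i Fin.< j → ∀ g → Q (suc g) (at θ (at φ i)) (at θ (at φ j))) →
           ∀ {i j} → i Fin.< j → ∀ g → Q g (at θ (at φ i)) (at θ (at φ j))
    both φ h′ lt zero = h (at-mono φ lt)
    both φ h′ lt (suc g) = h′ lt g

-- Binary lexicographic orders

-- Tags are listed from the most significant coordinate on. At a `free` coordinate the direction may
-- vary from node to node.
data Tag : Set where
  inc dec free : Tag

Edge : (B → B → Set) → Tag → B → B → Set
Edge R inc x y = R x y
Edge R dec x y = R y x
Edge R free x y = R x y ⊎ R y x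

All² : (B → B → Set) → (A → B) → (A → B) → Set
All² R f g = ∀ u v → R (f u) (g v)

sign : Bool → Tag
sign b = if b then inc else dec

-- f is ordered lexicographically; nothing is assumed on R, so B may itself consist of functions.
data Ordered {B : Set} (R : B → B → Set) : Vec Tag n → (Vec Bool n → B) → Set where
  [] : ∀ {f} → Ordered R [] f
  node : ∀ {t} {ts : Vec Tag n} {f} → Edge (All² R) t (f ∘ (false ∷_)) (f ∘ (true ∷_)) →
         Ordered R ts (f ∘ (false ∷_)) → Ordered R ts (f ∘ (true ∷_)) → Ordered R (t ∷ ts) f

edge-map : {R : B → B → Set} {S : C → C → Set} {x y : B} {x′ y′ : C} (t : Tag) →
           (R x y → S x′ y′) → (R y x → S y′ x′) → Edge R t x y → Edge S t x′ y′
edge-map inc h k = h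
edge-map dec h k = k
edge-map free h k (inj₁ p) = inj₁ (h p)
edge-map free h k (inj₂ p) = inj₂ (k p)

ordered-map : {R : B → B → Set} {S : C → C → Set} {ts : Vec Tag n} {f : Vec Bool n → B} {g : Vec Bool n → C} →
              (∀ u v → R (f u) (f v) → S (g u) (g v)) → Ordered R ts f → Ordered S ts g
ordered-map h [] = []
ordered-map h (node {t = t} p l r) =
  node (edge-map t (λ q u v → h _ _ (q u v)) (λ q u v → h _ _ (q u v)) p)
       (ordered-map (λ _ _ → h _ _) l) (ordered-map (λ _ _ → h _ _) r)

-- A comparison decided on one of the first levels holds whatever the later coordinates are; `All²`
-- records this once they have become arguments of the values.
ordered-prefix : {R : B → B → Set} (ts : Vec Tag m) {ts′ : Vec Tag n} {f : Vec Bool (m + n) → B} →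
                 Ordered R (ts ++ ts′) f → Ordered (All² R) ts (λ u v → f (u ++ v))
ordered-prefix [] o = []
ordered-prefix (t ∷ ts) (node p l r) =
  node (edge-map t (λ q u v i j → q (u ++ i) (v ++ j)) (λ q u v i j → q (u ++ i) (v ++ j)) p)
       (ordered-prefix ts l) (ordered-prefix ts r)

ordered-suffix : {R : B → B → Set} (ts : Vec Tag m) {ts′ : Vec Tag n} {f : Vec Bool (m + n) → B} →
                 Ordered R (ts ++ ts′) f → ∀ u → Ordered R ts′ (λ v → f (u ++ v))
ordered-suffix [] o [] = o
ordered-suffix (t ∷ ts) (node p l r) (false ∷ u) = ordered-suffix ts l u
ordered-suffix (t ∷ ts) (node p l r) (true ∷ u) = ordered-suffix ts r u

-- Comparisons on the upper levels cover every choice of the last bit already, so only the nodes of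
-- the last level need a hypothesis of their own.
ordered-snoc : {R : B → B → Set} (ts : Vec Tag n) {t : Tag} {f : Vec Bool (suc n) → B} →
               Ordered (All² R) ts (λ u b → f (u ∷ʳ b)) →
               (∀ u → Edge R t (f (u ∷ʳ false)) (f (u ∷ʳ true))) →
               Ordered R (ts ∷ʳ t) f
ordered-snoc [] {t} o h = node (edge-map t (λ { q [] [] → q }) (λ { q [] [] → q }) (h [])) [] []
ordered-snoc {R = R} (t ∷ ts) {f = f} (node p l r) h =
  node (edge-map t (ext false true) (ext true false) p)
       (ordered-snoc ts l (λ u → h (false ∷ u))) (ordered-snoc ts r (λ u → h (true ∷ u)))
  where
  ext : ∀ a b → All² (All² R) (λ u c → f ((a ∷ u) ∷ʳ c)) (λ u c → f ((b ∷ u) ∷ʳ c)) →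
        All² R (f ∘ (a ∷_)) (f ∘ (b ∷_))
  ext a b q u v with initLast u | initLast v
  ... | u′ , i , refl | v′ , j , refl = q u′ v′ i j

ordered-unsnoc : {R : B → B → Set} (n : ℕ) {t : Tag} {f : Vec Bool (suc n) → B} → Ordered R (replicate (suc n) t) f →
                 Ordered (All² R) (replicate n t) (λ u b → f (u ∷ʳ b)) ×
                 (∀ u → Edge R t (f (u ∷ʳ false)) (f (u ∷ʳ true)))
ordered-unsnoc zero {t} (node p _ _) = [] , λ { [] → edge-map t (λ q → q [] []) (λ q → q [] []) p }
ordered-unsnoc (suc n) {t} (node p l r) =
  node (edge-map t (λ q u v i j → q (u ∷ʳ i) (v ∷ʳ j)) (λ q u v i j → q (u ∷ʳ i) (v ∷ʳ j)) p)
       (proj₁ (ordered-unsnoc n l)) (proj₁ (ordered-unsnoc n r)) ,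
  λ { (false ∷ u) → proj₂ (ordered-unsnoc n l) u ; (true ∷ u) → proj₂ (ordered-unsnoc n r) u }

-- Subset sums and affine substitutions

dot : Vec ℕ n → Vec Bool n → ℕ
dot [] [] = 0
dot (x ∷ xs) (b ∷ v) = (if b then x else 0) + dot xs v

dot-++ : (xs : Vec ℕ m) {ys : Vec ℕ n} (u : Vec Bool m) {v : Vec Bool n} →
         dot (xs ++ ys) (u ++ v) ≡ dot xs u + dot ys v
dot-++ [] [] = refl
dot-++ (x ∷ xs) (b ∷ u) = trans (cong ((if b then x else 0) +_) (dot-++ xs u)) (sym (+-assoc (if b then x else 0) _ _))

dot-∷ʳ : (xs : Vec ℕ n) {y : ℕ} (u : Vec Bool n) {b : Bool} →
         dot (xs ∷ʳ y) (u ∷ʳ b) ≡ dot xs u + (if b then y else 0)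
dot-∷ʳ [] {y} [] {b} = +-identityʳ (if b then y else 0)
dot-∷ʳ (x ∷ xs) (b ∷ u) = trans (cong ((if b then x else 0) +_) (dot-∷ʳ xs u)) (sym (+-assoc (if b then x else 0) _ _))

dot≤sum : (xs : Vec ℕ n) (v : Vec Bool n) → dot xs v ≤ sum xs
dot≤sum [] [] = z≤n
dot≤sum (x ∷ xs) (false ∷ v) = ≤-trans (dot≤sum xs v) (m≤n+m _ x)
dot≤sum (x ∷ xs) (true ∷ v) = +-monoʳ-≤ x (dot≤sum xs v)

dot-ones : (xs : Vec ℕ n) → dot xs (replicate n true) ≡ sum xs
dot-ones [] = refl
dot-ones (x ∷ xs) = cong (x +_) (dot-ones xs)

dot-zeros : (xs : Vec ℕ n) → dot xs (replicate n false) ≡ 0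
dot-zeros [] = refl
dot-zeros (x ∷ xs) = dot-zeros xs

-- `φ` takes cubes to cubes: the base `c` and the generators `ys` of the new cube depend on `xs`,
-- but `φ` does not.
Affine : (Vec Bool d → Vec Bool n) → Set
Affine {d} {n} φ = ∀ xs → ∃₂ λ c ys → ∀ v → c + dot ys v ≡ dot xs (φ v)

affine-∘ : {φ : Vec Bool m → Vec Bool n} {ψ : Vec Bool d → Vec Bool m} → Affine φ → Affine ψ → Affine (φ ∘ ψ)
affine-∘ {ψ = ψ} aφ aψ xs with aφ xs
... | c , ys , p with aψ ys
... | c′ , zs , q = c + c′ , zs , λ v →
      trans (+-assoc c c′ _) (trans (cong (c +_) (q v)) (p (ψ v)))

-- Hilbert cubes and constant directions on every level

codes : ℕ → ℕ
codes zero = 2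
codes (suc n) = codes n * codes n

-- Numbers a two-colouring of the words of length `n` by its table of values, which opens colourings
-- to the pigeonhole principle.
code : (n : ℕ) → (Vec Bool n → Bool) → Fin (codes n)
code zero c = if c [] then zero else suc zero
code (suc n) c = combine (code n (c ∘ (false ∷_))) (code n (c ∘ (true ∷_)))

code-injective : ∀ n c c′ → code n c ≡ code n c′ → ∀ v → c v ≡ c′ v
code-injective zero c c′ eq [] with c [] | c′ []
... | true | true = refl
... | false | false = refl
code-injective (suc n) c c′ eq (false ∷ v) =
  code-injective n _ _ (proj₁ (combine-injective _ _ (code n _) (code n _) eq)) v
code-injective (suc n) c c′ eq (true ∷ v) =
  code-injective n _ _ (proj₂ (combine-injective (code n _) _ (code n _) _ eq)) v

-- Any two of the n + 1 words 1…10…0 bound a combinatorial line, which drives the pigeonhole step of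
-- the Hilbert cube lemma below.
step-word : Fin (suc n) → Vec Bool n
step-word zero = replicate _ false
step-word {suc n} (suc j) = true ∷ step-word j

step-word-mono : (xs : Vec ℕ n) {i j : Fin (suc n)} → i Fin.< j → dot xs (step-word i) ≤ dot xs (step-word j)
step-word-mono xs {zero} _ = ≤-trans (≤-reflexive (dot-zeros xs)) z≤n
step-word-mono (x ∷ xs) {suc i} {suc j} (s≤s i<j) = +-monoʳ-≤ x (step-word-mono xs i<j)

ordered-step-word : {R : B → B → Set} {t : Tag} {f : Vec Bool n → B} → Ordered R (replicate n t) f →
                    ∀ {i j} → i Fin.< j → Edge R t (f (step-word i)) (f (step-word j))
ordered-step-word {n = suc n} {t = t} (node p l r) {zero} {suc j} _ = edge-map t (λ q → q _ _) (λ q → q _ _) p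
ordered-step-word {n = suc n} (node p l r) {suc i} {suc j} (s≤s i<j) = ordered-step-word r i<j

-- One tag for all levels suffices: `inc` transports the index order and `free` the value order. `B`
-- is arbitrary because the values become functions when last coordinates are split off.
Embedding : (Vec Bool d → Vec Bool n) → Set₁
Embedding {d} {n} φ = ∀ {t} {B : Set} {R : B → B → Set} {f} →
  Ordered R (replicate n t) f → Ordered R (replicate d t) (f ∘ φ)

replicate-++ : ∀ m {n} (x : A) → replicate (m + n) x ≡ replicate m x ++ replicate n x
replicate-++ zero x = refl
replicate-++ (suc m) x = cong (x ∷_) (replicate-++ m x)

-- There is one more step word than there are colourings of the last `n` coordinates, so two step
-- words induce the same colouring. The new coordinate switches between these two, and induction
-- applies to the common colouring.
hilbert-cube : (d : ℕ) → ∃ λ n → ∀ (c : Vec Bool n → Bool) →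
  Σ (Vec Bool d → Vec Bool n) λ φ → Affine φ × Embedding φ × ∃ λ b → ∀ v → c (φ v) ≡ b
hilbert-cube zero = 0 , λ c → (λ v → v) , (λ xs → 0 , xs , λ _ → refl) , (λ o → o) , c [] , λ { [] → refl }
hilbert-cube (suc d) with hilbert-cube d
... | n , ih = codes n + n , λ c →
  let cs = λ (j : Fin (suc (codes n))) v → c (step-word j ++ v)
      i , j , i<j , eq = pigeonhole (n<1+n _) (λ j → code n (cs j))
      φ , affine , embed , b , mono = ih (cs i)
      ψ = λ (w : Vec Bool (suc d)) → extend φ i j w
  in ψ , extend-affine φ affine i<j , extend-embed φ embed i<j , b ,
     λ { (false ∷ v) → mono v
       ; (true ∷ v) → trans (sym (code-injective n (cs i) (cs j) eq (φ v))) (mono v) }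
  where
  extend : (Vec Bool d → Vec Bool n) → Fin (suc (codes n)) → Fin (suc (codes n)) → Vec Bool (suc d) → Vec Bool (codes n + n)
  extend φ i j (false ∷ v) = step-word i ++ φ v
  extend φ i j (true ∷ v) = step-word j ++ φ v

  extend-affine : ∀ φ → Affine φ → ∀ {i j} → i Fin.< j → Affine (extend φ i j)
  extend-affine φ affine {i} {j} i<j xs with splitAt (codes n) xs
  ... | as , bs , refl with affine bs
  -- The new generator is the gain from step word `i` to step word `j`; the truncated subtraction is
  -- exact by `step-word-mono`.
  ... | c , ys , eq = dot as wi + c , (dot as wj ∸ dot as wi) ∷ ys , λ
        { (false ∷ v) → trans (+-assoc (dot as wi) c _) (trans (cong (dot as wi +_) (eq v)) (sym (dot-++ as wi)))
        ; (true ∷ v) → trans (rearrange (dot as wi) c (dot as wj ∸ dot as wi) (dot ys v))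
            (trans (cong₂ _+_ (m+[n∸m]≡n (step-word-mono as i<j)) (eq v)) (sym (dot-++ as wj))) }
    where
    wi = step-word i
    wj = step-word j
    rearrange : ∀ a c x y → a + c + (x + y) ≡ a + x + (c + y)
    rearrange = solve-∀

  extend-embed : ∀ φ → Embedding φ → ∀ {i j} → i Fin.< j → Embedding (extend φ i j)
  extend-embed φ embed {i} {j} i<j {t} {R = R} {f = f} o =
    node (edge-map t (λ q u v → q (φ u) (φ v)) (λ q u v → q (φ u) (φ v))
           (ordered-step-word (ordered-prefix (replicate (codes n) t) o′) i<j))
         (embed (ordered-suffix (replicate (codes n) t) o′ (step-word i)))
         (embed (ordered-suffix (replicate (codes n) t) o′ (step-word j)))
    where
    o′ = subst (λ ts → Ordered R ts f) (replicate-++ (codes n) t) o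

replicate-∷ʳ : ∀ n (x : A) → replicate n x ∷ʳ x ≡ replicate (suc n) x
replicate-∷ʳ zero x = refl
replicate-∷ʳ (suc n) x = cong (x ∷_) (replicate-∷ʳ n x)

-- The lowest level is settled first: the directions at its nodes colour words, and a monochromatic
-- subcube leaves a single direction. Induction inside this subcube, with functions of the last bit
-- as values, settles the upper levels and keeps the last one constant.
tree-ramsey : (d : ℕ) → ∃ λ n → ∀ {B : Set} {R : B → B → Set} {f} → Ordered R (replicate n free) f →
  Σ (Vec Bool d → Vec Bool n) λ φ → Affine φ × Embedding φ × ∃ λ bs → Ordered R (map sign bs) (f ∘ φ)
tree-ramsey zero = 0 , λ _ → (λ v → v) , (λ xs → 0 , xs , λ _ → refl) , id , [] , []
tree-ramsey (suc d) with tree-ramsey d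
... | k , ih with hilbert-cube k
... | n , hilbert = suc n , λ {B} {R} {f} o →
  let o′ , last = ordered-unsnoc n o
      φ , affineφ , embed , c , mono = hilbert (λ u → isLeft (last u))
      ψ , affineψ , embed′ , bs , o″ = ih (embed o′)
  in snoc (φ ∘ ψ) , snoc-affine _ (affine-∘ {φ = φ} {ψ} affineφ affineψ) ,
     snoc-embed (φ ∘ ψ) (embed′ ∘ embed) , bs ∷ʳ c ,
     subst (λ ts → Ordered R ts (f ∘ snoc (φ ∘ ψ))) (sym (map-∷ʳ sign c bs))
       (ordered-snoc (map sign bs)
         (ordered-map (λ u v q i j → subst₂ R (sym (cong f (snoc-∷ʳ (φ ∘ ψ) u i))) (sym (cong f (snoc-∷ʳ (φ ∘ ψ) v j))) (q i j)) o″)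
         (λ u → top c R (sym (cong f (snoc-∷ʳ (φ ∘ ψ) u false))) (sym (cong f (snoc-∷ʳ (φ ∘ ψ) u true)))
                    (last (φ (ψ u))) (mono (ψ u))))
  where
  isLeft : ∀ {P Q : Set} → P ⊎ Q → Bool
  isLeft (inj₁ _) = true
  isLeft (inj₂ _) = false

  top : ∀ {B : Set} c (R : B → B → Set) {x y x′ y′ : B} → x ≡ x′ → y ≡ y′ → (s : R x y ⊎ R y x) → isLeft s ≡ c →
        Edge R (sign c) x′ y′
  top _ R refl refl (inj₁ p) refl = p
  top _ R refl refl (inj₂ p) refl = p

  snoc : (Vec Bool d → Vec Bool n) → Vec Bool (suc d) → Vec Bool (suc n)
  snoc φ w = let u , b , _ = initLast w in φ u ∷ʳ b

  snoc-∷ʳ : ∀ φ u b → snoc φ (u ∷ʳ b) ≡ φ u ∷ʳ b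
  snoc-∷ʳ φ u b with initLast (u ∷ʳ b)
  ... | u′ , b′ , eq with ∷ʳ-injective u u′ eq
  ... | refl , refl = refl

  snoc-embed : ∀ φ → Embedding φ → Embedding (snoc φ)
  snoc-embed φ embed {t} {R = R} {f} o =
    let o′ , top = ordered-unsnoc n o
    in subst (λ ts → Ordered R ts (f ∘ snoc φ)) (replicate-∷ʳ d t)
         (ordered-snoc (replicate d t)
           (ordered-map (λ u v q i j → subst₂ R (sym (cong f (snoc-∷ʳ φ u i))) (sym (cong f (snoc-∷ʳ φ v j))) (q i j)) (embed o′))
           (λ u → subst₂ (Edge R t) (sym (cong f (snoc-∷ʳ φ u false))) (sym (cong f (snoc-∷ʳ φ u true))) (top (φ u))))

  snoc-affine : ∀ φ → Affine φ → Affine (snoc φ)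
  snoc-affine φ affine xs with initLast xs
  ... | xs′ , x , refl with affine xs′
  ... | c , ys , eq = c , ys ∷ʳ x , go
    where
    go : ∀ w → c + dot (ys ∷ʳ x) w ≡ dot (xs′ ∷ʳ x) (snoc φ w)
    go w with initLast w
    ... | u , b , refl = trans (cong (c +_) (dot-∷ʳ ys u)) (trans (sym (+-assoc c _ _))
            (trans (cong (_+ (if b then x else 0)) (eq u)) (sym (dot-∷ʳ xs′ (φ u)))))

-- Grids

infix 4 _↪_
-- A function, unlike `Thin`, so that embeddings can be given by formulas such as `combine`.
record _↪_ (k n : ℕ) : Set where
  constructor emb
  field
    to : Fin k → Fin n
    mono : ∀ {i j} → i Fin.< j → to i Fin.< to j
open _↪_

infixr 9 _⊙_
_⊙_ : m ↪ n → k ↪ m → k ↪ n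
to (e ⊙ f) = to e ∘ to f
mono (e ⊙ f) = mono e ∘ mono f

thin↪ : Thin k n → k ↪ n
thin↪ θ = emb (at θ) (at-mono θ)

≤↪ : k ≤ n → k ↪ n
to (≤↪ le) i = inject≤ i le
mono (≤↪ le) {i} {j} lt = subst₂ _<_ (sym (toℕ-inject≤ i le)) (sym (toℕ-inject≤ j le)) lt

from-< : {P : Fin n → Fin n → Set} → (∀ {i j} → P i j → P j i) → (∀ {i j} → i Fin.< j → P i j) →
         ∀ {i j} → i ≢ j → P i j
from-< s h {i} {j} ne with Fin.<-cmp i j
... | tri< lt _ _ = h lt
... | tri≈ _ eq _ = ⊥-elim (ne eq)
... | tri> _ _ gt = s (h gt)

↪-≢ : (e : k ↪ n) → ∀ {i j} → i ≢ j → to e i ≢ to e j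
↪-≢ e = from-< {P = λ i j → to e i ≢ to e j} (_∘ sym) (λ lt eq → <-irrefl (cong toℕ eq) (mono e lt))

choose : Vec (n ↪ N) m → Vec (Fin n) m → Vec (Fin N) m
choose [] [] = []
choose (e ∷ es) (c ∷ w) = to e c ∷ choose es w

_⊙*_ : Vec (n ↪ N) m → Vec (k ↪ n) m → Vec (k ↪ N) m
[] ⊙* [] = []
(e ∷ es) ⊙* (f ∷ fs) = e ⊙ f ∷ es ⊙* fs

choose-⊙* : (es : Vec (n ↪ N) m) (fs : Vec (k ↪ n) m) (w : Vec (Fin k) m) →
            choose (es ⊙* fs) w ≡ choose es (choose fs w)
choose-⊙* [] [] [] = refl
choose-⊙* (e ∷ es) (f ∷ fs) (c ∷ w) = cong (_ ∷_) (choose-⊙* es fs w)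

Sep : (B → B → Set) → (A → B) → (A → B) → Set
Sep R f g = All² R f g ⊎ All² R g f

-- The analogue of `Ordered` with all tags `free` when a coordinate takes `n` values: siblings are
-- separated, in an order that may vary from node to node.
data GridTree (R : B → B → Set) : (Vec (Fin n) m → B) → Set where
  [] : {f : Vec (Fin n) 0 → B} → GridTree R f
  node : {f : Vec (Fin n) (suc m) → B} →
         (∀ {c c′} → c ≢ c′ → Sep R (f ∘ (c ∷_)) (f ∘ (c′ ∷_))) →
         (∀ c → GridTree R (f ∘ (c ∷_))) → GridTree R f

gridtree-map : {R : B → B → Set} {S : C → C → Set} {f : Vec (Fin n) m → B} {g : Vec (Fin n) m → C} →
            (∀ u v → R (f u) (f v) → S (g u) (g v)) → GridTree R f → GridTree S g
gridtree-map h [] = []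
gridtree-map h (node s t) =
  node (⊎-map (λ q u v → h _ _ (q u v)) (λ q u v → h _ _ (q u v)) ∘ s) (λ c → gridtree-map (λ _ _ → h _ _) (t c))

gridtree-choose : {R : B → B → Set} (es : Vec (n ↪ N) m) {f : Vec (Fin N) m → B} → GridTree R f → GridTree R (f ∘ choose es)
gridtree-choose [] [] = []
gridtree-choose (e ∷ es) (node s t) =
  node (⊎-map (λ q u v → q (choose es u) (choose es v)) (λ q u v → q (choose es u) (choose es v)) ∘ s ∘ ↪-≢ e)
       (λ c → gridtree-choose es (t (to e c)))

-- The parameter t of G w t takes the place j in the order of significance of the coordinates of w.
data InsertTree (R : B → B → Set) : Fin (suc m) → (Vec (Fin n) m → Fin n → B) → Set where
  here : {G : Vec (Fin n) m → Fin n → B} →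
         (∀ {t t′} → t ≢ t′ → Sep R (λ w → G w t) (λ w → G w t′)) →
         (∀ t → GridTree R (λ w → G w t)) → InsertTree R zero G
  there : {G : Vec (Fin n) (suc m) → Fin n → B} {j : Fin (suc m)} →
          (∀ {c c′} → c ≢ c′ → Sep (All² R) (λ w → G (c ∷ w)) (λ w → G (c′ ∷ w))) →
          (∀ c → InsertTree R j (λ w → G (c ∷ w))) → InsertTree R (suc j) G

inserttree-map : {R : B → B → Set} {S : C → C → Set} {j : Fin (suc m)} {G : Vec (Fin n) m → Fin n → B}
              {H : Vec (Fin n) m → Fin n → C} →
              (∀ u t v t′ → R (G u t) (G v t′) → S (H u t) (H v t′)) → InsertTree R j G → InsertTree S j H
inserttree-map h (here s g) =
  here (⊎-map (λ q u v → h _ _ _ _ (q u v)) (λ q u v → h _ _ _ _ (q u v)) ∘ s)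
       (λ t → gridtree-map (λ _ _ → h _ _ _ _) (g t))
inserttree-map h (there s g) =
  there (⊎-map (λ q u v i j → h _ _ _ _ (q u v i j)) (λ q u v i j → h _ _ _ _ (q u v i j)) ∘ s)
        (λ c → inserttree-map (λ _ _ _ _ → h _ _ _ _) (g c))

inserttree-choose : {R : B → B → Set} {j : Fin (suc m)} (es : Vec (n ↪ N) m) (τ : n ↪ N) {G : Vec (Fin N) m → Fin N → B} →
                 InsertTree R j G → InsertTree R j (λ w t → G (choose es w) (to τ t))
inserttree-choose es τ (here s g) =
  here (⊎-map (λ q u v → q (choose es u) (choose es v)) (λ q u v → q (choose es u) (choose es v)) ∘ s ∘ ↪-≢ τ)
       (λ t → gridtree-choose es (g (to τ t)))
inserttree-choose (e ∷ es) τ (there s g) =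
  there (⊎-map (λ q u v i j → q (choose es u) (choose es v) (to τ i) (to τ j))
               (λ q u v i j → q (choose es u) (choose es v) (to τ i) (to τ j)) ∘ s ∘ ↪-≢ e)
        (λ c → inserttree-choose es τ (g (to e c)))

extract : Fin (suc m) → Vec A (suc m) → A × Vec A m
extract zero (x ∷ xs) = x , xs
extract {m = suc m} (suc j) (x ∷ xs) = let y , ys = extract j xs in y , x ∷ ys

inserttree⇒gridtree : {R : B → B → Set} {j : Fin (suc m)} {G : Vec (Fin n) m → Fin n → B} → InsertTree R j G →
                GridTree R (λ w → let t , w′ = extract j w in G w′ t)
inserttree⇒gridtree (here s g) = node s g
inserttree⇒gridtree (there s g) =
  node (λ ne → ⊎-map (λ q u v → q _ _ _ _) (λ q u v → q _ _ _ _) (s ne)) (λ c → inserttree⇒gridtree (g c))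

-- Finiteness as exhaustive search between two alternatives, which may overlap; comparisons are
-- searched without being negated.
Searchable : Set → Set₁
Searchable A = ∀ {P Q : A → Set} → (∀ x → P x ⊎ Q x) → ∃ P ⊎ (∀ x → Q x)

search-Fin : Searchable (Fin n)
search-Fin {zero} h = inj₂ λ ()
search-Fin {suc n} h with h zero | search-Fin (h ∘ suc)
... | inj₁ p | _ = inj₁ (zero , p)
... | inj₂ _ | inj₁ (i , p) = inj₁ (suc i , p)
... | inj₂ q | inj₂ q′ = inj₂ λ { zero → q ; (suc i) → q′ i }

search-× : Searchable A → Searchable B → Searchable (A × B)
search-× sA sB h =
  ⊎-map (λ (x , y , p) → (x , y) , p) (λ q (x , y) → q x y) (sA (λ x → sB (λ y → h (x , y))))

search-Vec : Searchable A → Searchable (Vec A n)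
search-Vec {n = zero} sA h = ⊎-map (λ p → [] , p) (λ { q [] → q }) (h [])
search-Vec {n = suc n} sA h =
  ⊎-map (λ ((x , xs) , p) → x ∷ xs , p) (λ { q (x ∷ xs) → q (x , xs) })
    (search-× sA (search-Vec sA) (λ (x , xs) → h (x ∷ xs)))

-- Linear orders and the insertion of a parameter

Linear : (ℕ → ℕ → Set) → Set
Linear _≺_ = Transitive _≺_ × Trichotomous _≡_ _≺_

Pointwise : (B → B → Set) → (A → B) → (A → B) → Set
Pointwise R f g = ∀ x → R (f x) (g x)

module Order {_≺_ : ℕ → ℕ → Set} (linear : Linear _≺_) where
  ≺-trans : Transitive _≺_
  ≺-trans = proj₁ linear

  compare : Trichotomous _≡_ _≺_
  compare = proj₂ linear

  _≼_ : ℕ → ℕ → Set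
  i ≼ j = i ≡ j ⊎ i ≺ j

  ≺-≼-trans : ∀ {i j l} → i ≺ j → j ≼ l → i ≺ l
  ≺-≼-trans p (inj₁ refl) = p
  ≺-≼-trans p (inj₂ q) = ≺-trans p q

  ≼⊎≻ : ∀ i j → i ≼ j ⊎ j ≺ i
  ≼⊎≻ i j with compare i j
  ... | tri< p _ _ = inj₁ (inj₂ p)
  ... | tri≈ _ p _ = inj₁ (inj₁ p)
  ... | tri> _ _ p = inj₂ p

  ≢⇒≺⊎≻ : ∀ {i j} → i ≢ j → i ≺ j ⊎ j ≺ i
  ≢⇒≺⊎≻ {i} {j} ne with compare i j
  ... | tri< p _ _ = inj₁ p
  ... | tri≈ _ e _ = ⊥-elim (ne e)
  ... | tri> _ _ p = inj₂ p

  -- The ranges overlap as intervals: neither lies strictly below the other.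
  Linked : (A → ℕ) → (A → ℕ) → Set
  Linked f g = (∃₂ λ u v → f u ≼ g v) × (∃₂ λ u v → g u ≼ f v)

  sep⊎linked : Searchable A → (f g : A → ℕ) → Sep _≺_ f g ⊎ Linked f g
  sep⊎linked search f g with below f g | below g f
    where
    below : ∀ f g → (∃₂ λ u v → f u ≼ g v) ⊎ All² _≺_ g f
    below f g = ⊎-map id (λ h v u → h u v) (search λ u → search λ v → ≼⊎≻ (f u) (g v))
  ... | inj₂ p | _ = inj₁ (inj₂ p)
  ... | inj₁ _ | inj₂ p = inj₁ (inj₁ p)
  ... | inj₁ p | inj₁ q = inj₂ (p , q)

-- One tree orders the grid for every parameter, but it compares values at equal parameters only.
-- `InsertTree` improves this to comparisons across parameters on the levels above the inserted one.
Family : (ℕ → ℕ → Set) → ℕ → ℕ → Set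
Family _≺_ m n = Σ (Vec (Fin n) m → Fin n → ℕ) λ F →
  (∀ w {t t′} → t ≢ t′ → F w t ≢ F w t′) × GridTree (Pointwise _≺_) F

Insertion : (ℕ → ℕ → Set) → (n : ℕ) → (Vec (Fin N) m → Fin N → ℕ) → Set
Insertion {N} {m} _≺_ n F = Σ (Vec (n ↪ N) m) λ es → Σ (n ↪ N) λ τ → ∃ λ j →
  InsertTree _≺_ j (λ w t → F (choose es w) (to τ t))

Insertable : ℕ → ℕ → Set₁
Insertable m n = ∃ λ N → ∀ {_≺_} → Linear _≺_ → (F : Family _≺_ m N) → Insertion _≺_ n (proj₁ F)

restrict : ∀ {_≺_} (es : Vec (n ↪ N) m) (τ : n ↪ N) → Family _≺_ m N → Family _≺_ m n
restrict {_≺_ = _≺_} es τ (F , inj , g) = (λ w t → F (choose es w) (to τ t)) ,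
  (λ w ne → inj (choose es w) (↪-≢ τ ne)) ,
  gridtree-map {R = Pointwise _≺_} {f = F ∘ choose es} (λ _ _ h t → h (to τ t)) (gridtree-choose es g)

insertion-lift : ∀ {_≺_} (es : Vec (n ↪ N) m) (τ : n ↪ N) {F : Vec (Fin N) m → Fin N → ℕ} {fs : Vec (k ↪ n) m} {σ : k ↪ n} {j} →
  InsertTree _≺_ j (λ w t → F (choose es (choose fs w)) (to τ (to σ t))) →
  InsertTree _≺_ j (λ w t → F (choose (es ⊙* fs) w) (to (τ ⊙ σ) t))
insertion-lift {_≺_ = _≺_} es τ {F} {fs} {σ} = inserttree-map λ u t v t′ →
  subst₂ (λ x y → F x (to τ (to σ t)) ≺ F y (to τ (to σ t′))) (sym (choose-⊙* es fs u)) (sym (choose-⊙* es fs v))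

-- The families are treated in turn on shrinking subgrids, since a place found earlier survives
-- restriction. The final subgrid is common to all families, while the places may differ.
insert-simultaneously : (∀ n → Insertable m n) → ∀ q n → ∃ λ N → ∀ {_≺_} → Linear _≺_ → (Fs : Fin q → Family _≺_ m N) →
  Σ (Vec (n ↪ N) m) λ es → Σ (n ↪ N) λ τ → Σ (Fin q → Fin (suc m)) λ j →
  ∀ g → InsertTree _≺_ (j g) (λ w t → proj₁ (Fs g) (choose es w) (to τ t))
insert-simultaneously insertable zero n = n , λ _ _ → replicate _ (≤↪ ≤-refl) , ≤↪ ≤-refl , (λ ()) , λ ()
insert-simultaneously {m} insertable (suc q) n with insert-simultaneously insertable q n
... | N₁ , later with insertable N₁
... | size , first = size , go
  where
  go : ∀ {_≺_} → Linear _≺_ → (Fs : Fin (suc q) → Family _≺_ m size) →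
    Σ (Vec (n ↪ size) m) λ es → Σ (n ↪ size) λ τ → Σ (Fin (suc q) → Fin (suc m)) λ j →
    ∀ g → InsertTree _≺_ (j g) (λ w t → proj₁ (Fs g) (choose es w) (to τ t))
  go {_≺_} linear Fs with first linear (Fs zero)
  ... | es , τ , j₀ , ins with later linear (λ g → restrict {_≺_ = _≺_} es τ (Fs (suc g)))
  ... | fs , σ , j , inss = es ⊙* fs , τ ⊙ σ , (λ { zero → j₀ ; (suc g) → j g }) , λ
        { zero → insertion-lift es τ {F = proj₁ (Fs zero)} {fs = fs} {σ = σ} (inserttree-choose fs σ ins)
        ; (suc g) → insertion-lift es τ {F = proj₁ (Fs (suc g))} {fs = fs} {σ = σ} (inss g) }

combine-monoʳ-< : (i : Fin m) {j k : Fin n} → j Fin.< k → combine i j Fin.< combine i k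
combine-monoʳ-< {n = n} i {j} {k} lt =
  subst₂ _<_ (sym (toℕ-combine i j)) (sym (toℕ-combine i k)) (+-monoʳ-< (n * toℕ i) lt)

-- Select children of the root in monotone order and cut them into q groups, each a representative
-- followed by n further children. If for some group the values taken on these n children occupy
-- pairwise disjoint ranges for n parameters t, then t becomes the most significant coordinate.
-- Otherwise all these ranges overlap pairwise for many t, so that the values at distinct
-- representatives are separated uniformly in t, and t is inserted below each representative.
insertable : ∀ m n → Insertable m n
insertable zero n = n , λ linear (F , inj , _) → [] , ≤↪ ≤-refl , zero ,
  here (λ ne → ⊎-map (λ { p [] [] → p }) (λ { p [] [] → p })
                 (Order.≢⇒≺⊎≻ linear (inj [] (↪-≢ (≤↪ ≤-refl) ne))))
       (λ t → [])
insertable (suc m) n with pigeonholes (suc m) n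
-- The sizes: `q` groups, so that `n` of them agree on the place of the parameter; `r` parameters to
-- insert below `q` representatives at once; `s` parameters to find `n` separated or `r` linked
-- ones; `c` children to find a monotone sequence.
... | q , same-position with insert-simultaneously (insertable m) q n
... | r , insert-each with ramsey-family n q r
... | s , separate-or-link with ramsey (q * suc n) (q * suc n)
... | c , chain = size , go
  where
  -- The sum stands in for the maximum: each of the four sizes embeds as an initial segment.
  size = n + (r + (s + c))
  ιn : n ↪ size
  ιn = ≤↪ (m≤m+n n _)
  ιr : r ↪ size
  ιr = ≤↪ (≤-trans (m≤m+n r _) (m≤n+m _ n))
  ιs : s ↪ size
  ιs = ≤↪ (≤-trans (≤-trans (m≤m+n s c) (m≤n+m _ r)) (m≤n+m _ n))
  ιc : c ↪ size
  ιc = ≤↪ (≤-trans (≤-trans (m≤n+m c s) (m≤n+m _ r)) (m≤n+m _ n))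

  go : ∀ {_≺_} → Linear _≺_ → (F : Family _≺_ (suc m) size) → Insertion _≺_ n (proj₁ F)
  go {_≺_} linear (F , inj , node separated subtrees) =
    [ (λ (γ , up) → along γ true up) , (λ (γ , down) → along γ false down) ]′
      (chain {P = λ i j → Edge (All² (Pointwise _≺_)) inc (λ w → F (to ιc i ∷ w)) (λ w → F (to ιc j ∷ w))}
             {Q = λ i j → Edge (All² (Pointwise _≺_)) dec (λ w → F (to ιc i ∷ w)) (λ w → F (to ιc j ∷ w))}
             (λ lt → separated (↪-≢ ιc (λ { refl → <-irrefl refl lt }))))
    where
    open Order linear

    along : (γ : Thin (q * suc n) c) (b : Bool) →
            (∀ {i j} → i Fin.< j → Edge (All² (Pointwise _≺_)) (sign b)
              (λ w → F (to ιc (at γ i) ∷ w)) (λ w → F (to ιc (at γ j) ∷ w))) →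
            Insertion _≺_ n F
    along γ b ordered = [ (λ (g , θ , h) → on-top g θ h) , (λ (θ , h) → below θ h) ]′
        (separate-or-link {P = λ g i j → Sep _≺_ (hull g (to ιs i)) (hull g (to ιs j))}
          (λ g {i} {j} _ → sep⊎linked (search-× search-Fin (search-Vec search-Fin)) (hull g (to ιs i)) (hull g (to ιs j))))
      where
      child : q * suc n ↪ size
      child = ιc ⊙ thin↪ γ
      rep : q ↪ size
      to rep g = to child (combine g zero)
      mono rep lt = mono child (Fin.combine-monoˡ-< zero zero lt)
      group : Fin q → n ↪ size
      to (group g) a = to child (combine g (suc a))
      mono (group g) lt = mono child (combine-monoʳ-< g (s≤s lt))
      hull : Fin q → Fin size → Fin n × Vec (Fin size) m → ℕ
      hull g t (a , w) = F (to (group g) a ∷ w) t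

      on-top : ∀ g (θ : Thin n s) → (∀ {i j} → i Fin.< j → Sep _≺_ (hull g (to ιs (at θ i))) (hull g (to ιs (at θ j)))) →
               Insertion _≺_ n F
      on-top g θ h = es , τ , zero ,
        here (λ ne → ⊎-map (λ p → λ { (a ∷ u) (a′ ∷ v) → p (a , _) (a′ , _) })
                           (λ p → λ { (a ∷ u) (a′ ∷ v) → p (a , _) (a′ , _) })
               (from-< {P = λ i j → Sep _≺_ (hull g (to ιs (at θ i))) (hull g (to ιs (at θ j)))} ⊎-swap h ne))
             (λ t → gridtree-choose es (gridtree-map {R = Pointwise _≺_} {f = F} (λ _ _ p → p (to τ t)) (node separated subtrees)))
        where
        τ = ιs ⊙ thin↪ θ
        es = group g ∷ replicate m ιn

      below : (θ : Thin r s) → (∀ {i j} → i Fin.< j → ∀ g → Linked (hull g (to ιs (at θ i))) (hull g (to ιs (at θ j)))) →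
              Insertion _≺_ n F
      below θ linked =
        let fs , σ , j , ins = insert-each linear subfamily
            ρ , j₀ , same = same-position j
        in rep ⊙ thin↪ ρ ∷ ιrs ⊙* fs , τ ⊙ σ , suc j₀ ,
           there (λ ne → ⊎-map (λ p u v i j → p _ _ _ _) (λ p u v i j → p _ _ _ _)
                           (across* (↪-≢ (thin↪ ρ) ne)))
                 (λ a → insertion-lift ιrs τ {F = λ w → F (to rep (at ρ a) ∷ w)} {fs = fs} {σ = σ}
                          (subst (λ j → InsertTree _≺_ j (λ w t → proj₁ (subfamily (at ρ a)) (choose fs w) (to σ t))) (same a) (ins (at ρ a))))
        where
        τ : r ↪ size
        τ = ιs ⊙ thin↪ θ
        ιrs = replicate m ιr
        subfamily : Fin q → Family _≺_ m r
        subfamily g = restrict {_≺_ = _≺_} ιrs τ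
          ((λ w → F (to rep g ∷ w)) , (λ w → inj (to rep g ∷ w)) , subtrees (to rep g))

        link : ∀ g t t′ → Linked (hull g (to τ t)) (hull g (to τ t′)) ⊎ t ≡ t′
        link g t t′ with Fin.<-cmp t t′
        ... | tri< lt _ _ = inj₁ (linked lt g)
        ... | tri≈ _ e _ = inj₂ e
        ... | tri> _ _ gt = inj₁ (swap (linked gt g))

        rep<group : ∀ g a → combine {n = suc n} g zero Fin.< combine g (suc a)
        rep<group g a = combine-monoʳ-< g z<s
        group<rep : ∀ {g g′} a → g Fin.< g′ → combine {n = suc n} g (suc a) Fin.< combine g′ zero
        group<rep a lt = Fin.combine-monoˡ-< (suc a) zero lt

        Across : Fin q → Fin q → Set
        Across g g′ = Sep (All² _≺_) (λ w t → F (to rep g ∷ w) (to τ t)) (λ w t → F (to rep g′ ∷ w) (to τ t))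

        across : ∀ b → (∀ {i j} → i Fin.< j → Edge (All² (Pointwise _≺_)) (sign b)
                   (λ w → F (to child i ∷ w)) (λ w → F (to child j ∷ w))) →
                 ∀ {g g′} → g Fin.< g′ → Across g g′
        -- A sandwich: representative `g` at `t` lies below all of group `g` at `t`, some value of
        -- which is at most a value of group `g` at `t′`, and that lies below representative `g′` at
        -- `t′`.
        across true ordered {g} {g′} lt = inj₁ λ u v t t′ → case u v t t′ (link g t t′)
          where
          case : ∀ u v t t′ → Linked (hull g (to τ t)) (hull g (to τ t′)) ⊎ t ≡ t′ →
                 F (to rep g ∷ u) (to τ t) ≺ F (to rep g′ ∷ v) (to τ t′)
          case u v t t′ (inj₁ (((a , w) , (a′ , w′) , le) , _)) =
            ≺-trans (≺-≼-trans (ordered (rep<group g a) u w (to τ t)) le) (ordered (group<rep a′ lt) w′ v (to τ t′))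
          case u v t _ (inj₂ refl) = ordered (Fin.combine-monoˡ-< zero zero lt) u v (to τ t)
        across false ordered {g} {g′} lt = inj₂ λ u v t t′ → case u v t t′ (link g t′ t)
          where
          case : ∀ u v t t′ → Linked (hull g (to τ t′)) (hull g (to τ t)) ⊎ t′ ≡ t →
                 F (to rep g′ ∷ u) (to τ t) ≺ F (to rep g ∷ v) (to τ t′)
          case u v t t′ (inj₁ (_ , ((a , w) , (a′ , w′) , le))) =
            ≺-trans (≺-≼-trans (ordered (group<rep a lt) u w (to τ t)) le) (ordered (rep<group g a′) w′ v (to τ t′))
          case u v t _ (inj₂ refl) = ordered (Fin.combine-monoˡ-< zero zero lt) u v (to τ t)

        across* : ∀ {g g′} → g ≢ g′ → Across g g′
        across* = from-< {P = Across} ⊎-swap (across b ordered)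

-- Index order

tail≤sum : ∀ x (xs : Vec ℕ n) → sum xs ≤ sum (x ∷ xs)
tail≤sum x xs = m≤n+m (sum xs) x

sub : Thin k n → Vec A n → Vec A k
sub none _ = []
sub (take θ) (x ∷ xs) = x ∷ sub θ xs
sub (skip θ) (x ∷ xs) = sub θ xs

lookup-sub : (θ : Thin k n) (xs : Vec A n) (i : Fin k) → lookup (sub θ xs) i ≡ lookup xs (at θ i)
lookup-sub (take θ) (x ∷ xs) zero = refl
lookup-sub (take θ) (x ∷ xs) (suc i) = lookup-sub θ xs i
lookup-sub (skip θ) (x ∷ xs) i = lookup-sub θ xs i

spread : Thin k n → Vec Bool k → Vec Bool n
spread none _ = replicate _ false
spread (take θ) (b ∷ v) = b ∷ spread θ v
spread (skip θ) v = false ∷ spread θ v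

dot-sub : (θ : Thin k n) (xs : Vec ℕ n) (v : Vec Bool k) → dot (sub θ xs) v ≡ dot xs (spread θ v)
dot-sub none xs [] = sym (dot-zeros xs)
dot-sub (take θ) (x ∷ xs) (b ∷ v) = cong ((if b then x else 0) +_) (dot-sub θ xs v)
dot-sub (skip θ) (x ∷ xs) v = dot-sub θ xs v

sum-sub : (θ : Thin k n) (xs : Vec ℕ n) → sum (sub θ xs) ≤ sum xs
sum-sub θ xs = subst (_≤ sum xs) (trans (sym (dot-sub θ xs _)) (dot-ones (sub θ xs))) (dot≤sum xs _)

ordered-spread : ∀ {c} {R : B → B → Set} {ts : Vec Tag n} {f} (θ : Thin k n) → (∀ i → lookup ts (at θ i) ≡ c) →
                 Ordered R ts f → Ordered R (replicate k c) (f ∘ spread θ)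
ordered-spread none _ _ = []
ordered-spread (skip θ) h (node p l r) = ordered-spread θ h l
ordered-spread {c = c} (take θ) h (node p l r) with h zero
... | refl = node (edge-map c (λ q u v → q (spread θ u) (spread θ v)) (λ q u v → q (spread θ u) (spread θ v)) p)
                  (ordered-spread θ (h ∘ suc) l) (ordered-spread θ (h ∘ suc) r)

data SuperInc : Vec ℕ n → Set where
  [] : SuperInc []
  _∷_ : ∀ {x} {xs : Vec ℕ n} → sum xs < x → SuperInc xs → SuperInc (x ∷ xs)

superinc-sub : {xs : Vec ℕ n} (θ : Thin k n) → SuperInc xs → SuperInc (sub θ xs)
superinc-sub none _ = []
superinc-sub (take θ) (h ∷ s) = ≤-<-trans (sum-sub θ _) h ∷ superinc-sub θ s
superinc-sub (skip θ) (_ ∷ s) = superinc-sub θ s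

halving-superinc : (xs : Vec ℕ n) → (∀ i → 0 < lookup xs i) →
                   (∀ {i j} → i Fin.< j → lookup xs j + lookup xs j ≤ lookup xs i) → SuperInc xs
halving-superinc [] _ _ = []
halving-superinc (x ∷ []) pos _ = pos zero ∷ []
halving-superinc (x ∷ y ∷ ys) pos h with halving-superinc (y ∷ ys) (pos ∘ suc) (λ lt → h (s≤s lt))
... | lt ∷ si = <-≤-trans (+-monoʳ-< y lt) (h {zero} {suc zero} z<s) ∷ lt ∷ si

-- All later generators together cannot make up for the first one, so the numerical order of the
-- sums is lexicographic.
superinc-ordered : {xs : Vec ℕ n} → SuperInc xs → Ordered _<_ (replicate n inc) (dot xs)
superinc-ordered [] = []
superinc-ordered (_∷_ {x = x} {xs} h si) =
  node (λ u v → ≤-<-trans (dot≤sum xs u) (<-≤-trans h (m≤m+n x (dot xs v))))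
       (superinc-ordered si) (ordered-map (λ _ _ → +-monoʳ-< x) (superinc-ordered si))

-- Comparing 01...1 with 10...0 recovers each inequality. Thus generators merged by an `Embedding`
-- remain superincreasing.
ordered-superinc : (xs : Vec ℕ n) → Ordered _<_ (replicate n inc) (dot xs) → SuperInc xs
ordered-superinc [] _ = []
ordered-superinc (x ∷ xs) (node p l _) =
  subst₂ _<_ (dot-ones xs) (trans (cong (x +_) (dot-zeros xs)) (+-identityʳ x)) (p (replicate _ true) (replicate _ false))
  ∷ ordered-superinc xs l

-- The counterpart of `SuperInc` for lists from small to large; `s` accumulates the entries already
-- passed on top of a starting value.
data Asc : ℕ → Vec ℕ n → Set where
  [] : ∀ {s} → Asc s []
  _∷_ : ∀ {s x} {xs : Vec ℕ n} → s < x → Asc (s + x) xs → Asc s (x ∷ xs)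

doubling-asc : (xs : Vec ℕ n) → (∀ i → 0 < lookup xs i) →
               (∀ {i j} → i Fin.< j → lookup xs i + lookup xs i ≤ lookup xs j) → Asc 0 xs
doubling-asc [] _ _ = []
doubling-asc (x ∷ xs) pos h = from (pos zero) h
  where
  from : ∀ {n s x} {xs : Vec ℕ n} → s < x →
         (∀ {i j} → i Fin.< j → lookup (x ∷ xs) i + lookup (x ∷ xs) i ≤ lookup (x ∷ xs) j) → Asc s (x ∷ xs)
  from {xs = []} lt h = lt ∷ []
  from {x = x} {xs = y ∷ ys} lt h = lt ∷ from (<-≤-trans (+-monoˡ-< x lt) (h {zero} {suc zero} z<s)) (λ l → h (s≤s l))

asc-++ : ∀ {s} (xs : Vec ℕ m) {ys : Vec ℕ n} → Asc s (xs ++ ys) → Asc (s + sum xs) ys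
asc-++ {s = s} [] a = subst (λ s → Asc s _) (sym (+-identityʳ s)) a
asc-++ {s = s} (x ∷ xs) {ys} (_ ∷ a) = subst (λ s → Asc s ys) (+-assoc s x (sum xs)) (asc-++ xs a)

asc-∷ʳ : ∀ {s} (xs : Vec ℕ n) {y} → Asc s (xs ∷ʳ y) → Asc s xs × s + sum xs < y
asc-∷ʳ {s = s} [] {y} (h ∷ []) = [] , subst (_< y) (sym (+-identityʳ s)) h
asc-∷ʳ {s = s} (x ∷ xs) {y} (h ∷ a) =
  let a′ , h′ = asc-∷ʳ xs a in h ∷ a′ , subst (_< y) (+-assoc s x (sum xs)) h′

sum-∷ʳ : (xs : Vec ℕ n) {y : ℕ} → sum (xs ∷ʳ y) ≡ sum xs + y
sum-∷ʳ [] {y} = +-identityʳ y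
sum-∷ʳ (x ∷ xs) = trans (cong (x +_) (sum-∷ʳ xs)) (sym (+-assoc x (sum xs) _))

-- The generators bᵢ + z_{d+1-i}; since every z exceeds the sum of all b, their size is governed by z.
add-reversed : ∀ {s} (bs : Vec ℕ d) (zs : Vec ℕ d) → sum bs ≤ s → Asc s zs →
  ∃ λ cs → SuperInc cs × sum cs ≡ sum bs + sum zs ×
  Σ (Vec Bool d → Vec Bool d) λ ψ → ∀ v → dot cs v ≡ dot bs v + dot zs (ψ v)
add-reversed [] [] _ _ = [] , [] , refl , (λ v → v) , λ { [] → refl }
add-reversed {s = s} (b ∷ bs) zs b+bs≤s asc with initLast zs
... | zs′ , z , refl =
  let asc′ , lt = asc-∷ʳ zs′ asc
      bs≤s = ≤-trans (tail≤sum b bs) b+bs≤s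
      cs , si , total , ψ , eq = add-reversed bs zs′ bs≤s asc′
  in b + z ∷ cs ,
     ≤-<-trans (≤-trans (≤-reflexive total) (+-monoˡ-≤ (sum zs′) bs≤s)) (<-≤-trans lt (m≤n+m z b)) ∷ si ,
     trans (cong (b + z +_) total)
       (trans (rearrange b z (sum bs) (sum zs′)) (cong (b + sum bs +_) (sym (sum-∷ʳ zs′)))) ,
     (λ { (c ∷ v) → ψ v ∷ʳ c }) ,
     λ { (false ∷ v) → trans (eq v) (cong (dot bs v +_) (sym (trans (dot-∷ʳ zs′ (ψ v)) (+-identityʳ _))))
       ; (true ∷ v) → trans (cong (b + z +_) (eq v))
           (trans (rearrange b z (dot bs v) (dot zs′ (ψ v))) (cong (b + dot bs v +_) (sym (dot-∷ʳ zs′ (ψ v))))) }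
  where
  rearrange : ∀ b z x y → b + z + (x + y) ≡ b + x + (y + z)
  rearrange = solve-∀

-- Cubes on which index and value follow the same lexicographic order

MonotoneCube : ℕ → ℕ → (ℕ → ℕ → Set) → Set
MonotoneCube d M _≺_ = ∃₂ λ x₀ (xs : Vec ℕ d) → SuperInc xs × x₀ + sum xs < M ×
  ∃ λ b → Ordered _≺_ (replicate d (sign b)) (λ v → x₀ + dot xs v)

-- Among `d + d` levels some `d` share a direction; the remaining coordinates are frozen at `false`.
sign-select : ∀ {_≺_ M x₀} {xs : Vec ℕ (d + d)} (bs : Vec Bool (d + d)) → SuperInc xs → x₀ + sum xs < M →
              Ordered _≺_ (map sign bs) (λ v → x₀ + dot xs v) → MonotoneCube d M _≺_
sign-select {d} {_≺_} {M} {x₀} {xs} bs si bound o =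
  [ along true , along false ]′ (select d d ≤-refl (λ i → true-or-false (lookup bs i)))
  where
  true-or-false : ∀ b → b ≡ true ⊎ b ≡ false
  true-or-false true = inj₁ refl
  true-or-false false = inj₂ refl
  along : ∀ b → (∃ λ (θ : Thin d (d + d)) → ∀ i → lookup bs (at θ i) ≡ b) → MonotoneCube d M _≺_
  along b (θ , h) = x₀ , sub θ xs , superinc-sub θ si , ≤-<-trans (+-monoʳ-≤ x₀ (sum-sub θ xs)) bound , b ,
    ordered-map (λ u v → subst₂ _≺_ (cong (x₀ +_) (sym (dot-sub θ xs u))) (cong (x₀ +_) (sym (dot-sub θ xs v))))
      (ordered-spread θ (λ i → trans (lookup-map (at θ i) sign bs) (cong sign (h i))) o)

-- Here both orders rank the generators alike. Superincrease passes to the merged generators because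
-- it is equivalent to a lexicographic ordering, which embeddings preserve.
descending-cube : (d : ℕ) → ∃ λ n → ∀ {_≺_ M x₀} {xs : Vec ℕ n} → SuperInc xs → x₀ + sum xs < M →
                  Ordered _≺_ (replicate n free) (λ v → x₀ + dot xs v) → MonotoneCube d M _≺_
descending-cube d with tree-ramsey (d + d)
... | n , ramsey-n = n , λ {_≺_} {M} {x₀} {xs} → go {_≺_} {M} {x₀} {xs}
  where
  go : ∀ {_≺_ M x₀ xs} → SuperInc xs → x₀ + sum xs < M →
       Ordered _≺_ (replicate n free) (λ v → x₀ + dot xs v) → MonotoneCube d M _≺_
  go {_≺_} {M} {x₀} {xs} si bound o with ramsey-n o
  ... | φ , affine , embed , bs , o′ with affine xs
  ... | c , ys , eq = sign-select bs
    (ordered-superinc ys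
      (ordered-map (λ u v lt → +-cancelˡ-< c _ _ (subst₂ _<_ (sym (eq u)) (sym (eq v)) lt)) (embed (superinc-ordered si))))
    (≤-<-trans (≤-trans (≤-reflexive (trans (cong (x₀ + c +_) (sym (dot-ones ys))) (value _)))
                        (+-monoʳ-≤ x₀ (dot≤sum xs _))) bound)
    (ordered-map (λ u v → subst₂ _≺_ (sym (value u)) (sym (value v))) o′)
    where
    value : ∀ v → x₀ + c + dot ys v ≡ x₀ + dot xs (φ v)
    value v = trans (+-assoc x₀ c _) (cong (x₀ +_) (eq v))

-- The first `k` generators, smallest in size but most significant for values, are merged into
-- `d + d` ones. Adding the last `d + d` generators in reverse turns the ranking by size around and
-- leaves the order by value untouched.
ascending-cube : (d : ℕ) → ∃ λ n → ∀ {_≺_ M x₀} {xs : Vec ℕ n} → Asc 0 xs → x₀ + sum xs < M →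
            Ordered _≺_ (replicate n free) (λ v → x₀ + dot xs v) → MonotoneCube d M _≺_
ascending-cube d with tree-ramsey (d + d)
... | k , ramsey-k = k + (d + d) , λ {_≺_} {M} {x₀} {xs} → go {_≺_} {M} {x₀} {xs}
  where
  go : ∀ {_≺_ M x₀ xs} → Asc 0 xs → x₀ + sum xs < M → Ordered _≺_ (replicate (k + (d + d)) free) (λ v → x₀ + dot xs v) →
       MonotoneCube d M _≺_
  go {_≺_} {M} {x₀} {xs} asc bound o with splitAt k xs
  ... | as , zs , refl
    with ramsey-k (ordered-prefix (replicate k free) (subst (λ ts → Ordered _≺_ ts (λ v → x₀ + dot (as ++ zs) v)) (replicate-++ k free) o))
  ... | φ , affine , _ , bs , o′ with affine as
  ... | c , ys , eq
    -- The word of ones shows that the merged generators sum to at most `sum as`, which every entry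
    -- of `zs` exceeds.
    with add-reversed ys zs
           (≤-trans (m≤n+m (sum ys) c)
             (subst (_≤ sum as) (trans (sym (eq _)) (cong (c +_) (dot-ones ys))) (dot≤sum as (φ (replicate _ true)))))
           (asc-++ as asc)
  ... | cs , si , _ , ψ , eq′ = sign-select bs si bound′ o″
    where
    rearrange : ∀ x c y z → x + c + (y + z) ≡ x + (c + y + z)
    rearrange = solve-∀
    value : ∀ v → x₀ + c + dot cs v ≡ x₀ + dot (as ++ zs) (φ v ++ ψ v)
    value v = trans (cong (x₀ + c +_) (eq′ v)) (trans (rearrange x₀ c (dot ys v) (dot zs (ψ v)))
      (cong (x₀ +_) (trans (cong (_+ dot zs (ψ v)) (eq v)) (sym (dot-++ as (φ v))))))
    bound′ : x₀ + c + sum cs < M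
    bound′ = ≤-<-trans (≤-trans (≤-reflexive (trans (cong (x₀ + c +_) (sym (dot-ones cs))) (value _)))
                                (+-monoʳ-≤ x₀ (dot≤sum (as ++ zs) _))) bound
    o″ : Ordered _≺_ (map sign bs) (λ v → x₀ + c + dot cs v)
    -- `o′` compares functions of the last `d + d` coordinates, so any words may be put there, in
    -- particular `ψ u` and `ψ v`.
    o″ = ordered-map (λ u v h → subst₂ _≺_ (sym (value u)) (sym (value v)) (h (ψ u) (ψ v))) o′

-- Construction of grids of indices

gridSum : Vec (Fin n → ℕ) m → Vec (Fin n) m → ℕ
gridSum [] [] = 0
gridSum (X ∷ Xs) (c ∷ w) = X c + gridSum Xs w

-- The factor two survives passing to differences and yields superincreasing sequences.
Dominates Comparable : (Fin n → ℕ) → (Fin n → ℕ) → Set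
Dominates X Y = ∀ c c′ → c Fin.< c′ → ∀ e → X c + (Y e + Y e) ≤ X c′
Comparable X Y = Dominates X Y ⊎ Dominates Y X

Increasing : (Fin n → ℕ) → Set
Increasing X = ∀ c c′ → c Fin.< c′ → X c < X c′

-- The coordinates are listed by significance for values; their scales in the index are only
-- pairwise comparable, in whichever direction.
Grid : ℕ → ℕ → ℕ → (ℕ → ℕ → Set) → Set
Grid m n M _≺_ = Σ (Vec (Fin n → ℕ) m) λ Xs → AllPairs Comparable Xs × All Increasing Xs ×
  (∀ w → gridSum Xs w < M) × GridTree _≺_ (gridSum Xs)

subgrid : Vec (Fin N → ℕ) m → Vec (n ↪ N) m → Vec (Fin n → ℕ) m
subgrid = zipWith (λ X e c → X (to e c))

gridSum-subgrid : (Xs : Vec (Fin N → ℕ) m) (es : Vec (n ↪ N) m) (w : Vec (Fin n) m) →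
               gridSum (subgrid Xs es) w ≡ gridSum Xs (choose es w)
gridSum-subgrid [] [] [] = refl
gridSum-subgrid (X ∷ Xs) (e ∷ es) (c ∷ w) = cong (X (to e c) +_) (gridSum-subgrid Xs es w)

all-subgrid : {P : (Fin N → ℕ) → Set} {Q : (Fin n → ℕ) → Set} → (∀ {X} (e : n ↪ N) → P X → Q (X ∘ to e)) →
              {Xs : Vec (Fin N → ℕ) m} (es : Vec (n ↪ N) m) → All P Xs → All Q (subgrid Xs es)
all-subgrid h [] [] = []
all-subgrid h (e ∷ es) (p ∷ ps) = h e p ∷ all-subgrid h es ps

comparable-subgrid : {Xs : Vec (Fin N → ℕ) m} (es : Vec (n ↪ N) m) → AllPairs Comparable Xs →
                     AllPairs Comparable (subgrid Xs es)
comparable-subgrid [] [] = []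
comparable-subgrid (e ∷ es) (ps ∷ pss) =
  all-subgrid (λ f → ⊎-map (λ h _ _ lt i → h _ _ (mono e lt) (to f i)) (λ h _ _ lt i → h _ _ (mono f lt) (to e i))) es ps
  ∷ comparable-subgrid es pss

gridSum-insertAt : (Xs : Vec (Fin n → ℕ) m) (j : Fin (suc m)) (T : Fin n → ℕ) (w : Vec (Fin n) (suc m)) →
                gridSum (insertAt Xs j T) w ≡ (let t , w′ = extract j w in T t + gridSum Xs w′)
gridSum-insertAt Xs zero T (c ∷ w) = refl
gridSum-insertAt (X ∷ Xs) (suc j) T (c ∷ w) = trans (cong (X c +_) (gridSum-insertAt Xs j T w))
  (rearrange (X c) (T (proj₁ (extract j w))) (gridSum Xs (proj₂ (extract j w))))
  where
  rearrange : ∀ x y z → x + (y + z) ≡ y + (x + z)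
  rearrange = solve-∀

all-insertAt : {P : A → Set} {xs : Vec A m} (j : Fin (suc m)) {y : A} → P y → All P xs → All P (insertAt xs j y)
all-insertAt zero p ps = p ∷ ps
all-insertAt (suc j) p (q ∷ ps) = q ∷ all-insertAt j p ps

comparable-insertAt : {Xs : Vec (Fin n → ℕ) m} (j : Fin (suc m)) {T : Fin n → ℕ} → All (Dominates T) Xs →
                      AllPairs Comparable Xs → AllPairs Comparable (insertAt Xs j T)
comparable-insertAt zero ds ps = All.map inj₁ ds ∷ ps
comparable-insertAt (suc j) (d ∷ ds) (p ∷ ps) = all-insertAt j (inj₂ d) p ∷ comparable-insertAt j ds ps

coordinate-bound : ∀ {M} (Xs : Vec (Fin n → ℕ) m) → (∀ w → gridSum Xs w ≤ M) → All (λ X → ∀ c → X c ≤ M) Xs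
coordinate-bound Xs h = diagonal Xs (λ c → h (replicate _ c))
  where
  diagonal : ∀ {n m M} (Xs : Vec (Fin n → ℕ) m) → (∀ c → gridSum Xs (replicate m c) ≤ M) → All (λ X → ∀ c → X c ≤ M) Xs
  diagonal [] _ = []
  diagonal (X ∷ Xs) h = (λ c → ≤-trans (m≤m+n (X c) _) (h c)) ∷ diagonal Xs (λ c → ≤-trans (m≤n+m _ (X c)) (h c))

funToFin-injective : (f g : Fin m → Fin n) → funToFin f ≡ funToFin g → ∀ i → f i ≡ g i
funToFin-injective f g eq i =
  trans (sym (finToFun-funToFin f i)) (trans (cong (λ c → finToFun c i) eq) (finToFun-funToFin g i))

indicator : ∀ {P : Set} → Dec P → Fin 2
indicator (yes _) = suc zero
indicator (no _) = zero

indicator-transfer : ∀ {P Q : Set} (p? : Dec P) (q? : Dec Q) → indicator p? ≡ indicator q? → P → Q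
indicator-transfer _ (yes q) _ _ = q
indicator-transfer (no ¬p) (no _) _ p = ⊥-elim (¬p p)

-- Lets the induction hypothesis of `grid` be applied inside a block that starts at `t`.
shift-linear : ∀ {_≺_} → Linear _≺_ → ∀ t → Linear (λ i j → (t + i) ≺ (t + j))
shift-linear {_≺_} (≺-trans , compare) t = ≺-trans , cmp
  where
  cmp : Trichotomous _≡_ (λ i j → (t + i) ≺ (t + j))
  cmp i j with compare (t + i) (t + j)
  ... | tri< p q r = tri< p (q ∘ cong (t +_)) r
  ... | tri≈ p q r = tri≈ p (+-cancelˡ-≡ t i j q) r
  ... | tri> p q r = tri> p (q ∘ cong (t +_)) r

-- The blocks have length M and are M apart, so that their distances dominate all indices below M.
isomorphic-blocks : ∀ k M → ∃ λ q → ∀ {_≺_} → Linear _≺_ →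
  ∃ λ (θ : Thin k q) → ∀ a b → let s = toℕ (at θ a) * (M + M); t = toℕ (at θ b) * (M + M) in
  ∀ {i j} → i < M → j < M → (s + i) ≺ (s + j) → (t + i) ≺ (t + j)
-- A block is coloured by the table of all comparisons inside it: `M` rows of `M` bits.
isomorphic-blocks k M with pigeonholes ((2 ^ M) ^ M) k
... | q , same-color = q , go
  where
  start : Fin q → ℕ
  start c = toℕ c * (M + M)
  go : ∀ {_≺_} → Linear _≺_ → ∃ λ (θ : Thin k q) → ∀ a b {i j} → i < M → j < M →
       (start (at θ a) + i) ≺ (start (at θ a) + j) → (start (at θ b) + i) ≺ (start (at θ b) + j)
  go {_≺_} (_ , compare) =
    let θ , color , same = same-color (λ c → funToFin (row c)) in
    θ , λ a b i<M j<M →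
      subst₂ (λ i j → (start (at θ a) + i) ≺ (start (at θ a) + j) → (start (at θ b) + i) ≺ (start (at θ b) + j))
        (toℕ-fromℕ< i<M) (toℕ-fromℕ< j<M)
        (indicator-transfer (before (at θ a) (fromℕ< i<M) (fromℕ< j<M)) (before (at θ b) (fromℕ< i<M) (fromℕ< j<M))
          (funToFin-injective (λ j → indicator (before (at θ a) (fromℕ< i<M) j)) (λ j → indicator (before (at θ b) (fromℕ< i<M) j))
            (funToFin-injective (row (at θ a)) (row (at θ b)) (trans (same a) (sym (same b))) (fromℕ< i<M)) (fromℕ< j<M)))
    where
    before : ∀ c (i j : Fin M) → Dec ((start c + toℕ i) ≺ (start c + toℕ j))
    before c i j = tri⇒dec< compare _ _
    row : Fin q → Fin M → Fin (2 ^ M)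
    row c i = funToFin (λ j → indicator (before c i j))

grid : ∀ m n → ∃ λ M → ∀ {_≺_} → Linear _≺_ → Grid m n M _≺_
grid zero n = 1 , λ _ → [] , [] , [] , (λ { [] → s≤s z≤n }) , []
grid (suc m) n with insertable m n
... | N , insert with grid m N
-- The induction hypothesis builds its grid in block zero; the other `N` blocks carry copies of it
-- and provide the values of the parameter.
... | M , ih with isomorphic-blocks (suc N) M
... | q , blocks = q * (M + M) , go
  where
  go : ∀ {_≺_} → Linear _≺_ → Grid (suc m) n (q * (M + M)) _≺_
  go {_≺_} linear with blocks linear
  ... | θ , iso with ih (shift-linear linear (toℕ (at θ zero) * (M + M)))
  ... | Xs , comparable , increasing , bound , tree = result
    where
    block : Fin N → ℕ
    block t = toℕ (at θ (suc t)) * (M + M)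

    far : ∀ {t t′} → t Fin.< t′ → block t + (M + M) ≤ block t′
    far {t} lt = ≤-trans (≤-reflexive (+-comm (block t) (M + M))) (*-monoˡ-≤ (M + M) (at-mono θ (s≤s lt)))

    -- Some word is required to see that `M` is positive: its grid sum lies below `M`.
    block-mono : Vec (Fin N) m → ∀ {t t′} → t Fin.< t′ → block t < block t′
    block-mono w lt = <-≤-trans (m<m+n _ (≤-trans (≤-<-trans z≤n (bound w)) (m≤m+n M M))) (far lt)

    family : Family _≺_ m N
    family = (λ w t → block t + gridSum Xs w) ,
      (λ w → from-< {P = λ t t′ → block t + gridSum Xs w ≢ block t′ + gridSum Xs w} (_∘ sym)
        (λ lt eq → <-irrefl (+-cancelʳ-≡ (gridSum Xs w) _ _ eq) (block-mono w lt))) ,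
      gridtree-map (λ u v p t → iso zero (suc t) (bound u) (bound v) p) tree

    result : Grid (suc m) n (q * (M + M)) _≺_
    result with insert linear family
    ... | es , τ , j , ins =
      insertAt (subgrid Xs es) j T ,
      comparable-insertAt j
        -- Old coordinates are at most `M`, and starts of blocks differ by at least `M + M`; this is
        -- the factor two of `Dominates`.
        (all-subgrid (λ e h c c′ lt i → ≤-trans (+-monoʳ-≤ (T c) (+-mono-≤ (h (to e i)) (h (to e i)))) (far (mono τ lt)))
          es (coordinate-bound Xs (<⇒≤ ∘ bound)))
        (comparable-subgrid es comparable) ,
      all-insertAt j (λ c _ lt → block-mono (choose es (replicate m c)) (mono τ lt))
        (all-subgrid (λ e h _ _ lt → h _ _ (mono e lt)) es increasing) ,
      (λ w → subst (_< q * (M + M)) (sym (value w)) (small (proj₁ (extract j w)) (choose es (proj₂ (extract j w))))) ,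
      gridtree-map (λ u v → subst₂ _≺_ (sym (value u)) (sym (value v))) (inserttree⇒gridtree ins)
      where
      T : Fin n → ℕ
      T = block ∘ to τ
      value : ∀ w → gridSum (insertAt (subgrid Xs es) j T) w ≡
                    T (proj₁ (extract j w)) + gridSum Xs (choose es (proj₂ (extract j w)))
      value w = trans (gridSum-insertAt (subgrid Xs es) j T w) (cong (_ +_) (gridSum-subgrid Xs es _))
      small : ∀ t w → T t + gridSum Xs w < q * (M + M)
      small t w = <-≤-trans (+-monoʳ-< (T t) (<-≤-trans (bound w) (m≤m+n M M)))
        (≤-trans (≤-reflexive (+-comm (T t) (M + M))) (*-monoˡ-≤ (M + M) (toℕ<n (at θ (suc (to τ t))))))

-- From binary grids to monotone cubes

digit : Bool → Fin 2
digit false = zero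
digit true = suc zero

gridtree-binary : {R : B → B → Set} {f : Vec (Fin 2) m → B} → GridTree R f → Ordered R (replicate m free) (f ∘ map digit)
gridtree-binary [] = []
gridtree-binary (node s t) =
  node (⊎-map (λ q u v → q _ _) (λ q u v → q _ _) (s {zero} {suc zero} (λ ())))
       (gridtree-binary (t zero)) (gridtree-binary (t (suc zero)))

width : (Fin 2 → ℕ) → ℕ
width X = X (suc zero) ∸ X zero

gridSum-binary : (Xs : Vec (Fin 2 → ℕ) m) → All Increasing Xs → ∀ v →
              sum (map (λ X → X zero) Xs) + dot (map width Xs) v ≡ gridSum Xs (map digit v)
gridSum-binary [] [] [] = refl
gridSum-binary (X ∷ Xs) (h ∷ hs) (b ∷ v) =
  trans (rearrange (X zero) _ (if b then width X else 0) _) (cong₂ _+_ (end b) (gridSum-binary Xs hs v))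
  where
  rearrange : ∀ a b c d → a + b + (c + d) ≡ a + c + (b + d)
  rearrange = solve-∀
  end : ∀ b → X zero + (if b then width X else 0) ≡ X (digit b)
  end false = +-identityʳ _
  end true = m+[n∸m]≡n (<⇒≤ (h zero (suc zero) z<s))

dominates-width : ∀ {X Y} → Dominates X Y → width Y + width Y ≤ width X
dominates-width {X} {Y} h = ≤-trans (+-mono-≤ width≤ width≤)
  (m+n≤o⇒m≤o∸n _ (≤-trans (≤-reflexive (+-comm _ (X zero))) (h zero (suc zero) z<s (suc zero))))
  where
  width≤ : width Y ≤ Y (suc zero)
  width≤ = m∸n≤m (Y (suc zero)) (Y zero)

allpairs-lookup : {R : A → A → Set} {xs : Vec A n} → AllPairs R xs → ∀ {i j} → i Fin.< j → R (lookup xs i) (lookup xs j)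
allpairs-lookup (p ∷ ps) {zero} {suc j} _ = All.lookup⁺ p j
allpairs-lookup (p ∷ ps) {suc i} {suc j} (s≤s lt) = allpairs-lookup ps lt

-- A grid with two values per coordinate is a cube generated by the widths. Any two widths differ at
-- least by a factor of two, so Ramsey's theorem gives a long sublist that always halves or always
-- doubles.
monotone-cube : (d : ℕ) → ∃ λ M → ∀ {_≺_} → Linear _≺_ → MonotoneCube d M _≺_
monotone-cube d with descending-cube d | ascending-cube d
... | k , descending | l , ascending with ramsey k l
... | m , chain with grid m 2
... | M , grid₂ = M , go
  where
  go : ∀ {_≺_} → Linear _≺_ → MonotoneCube d M _≺_
  go {_≺_} linear with grid₂ linear
  ... | Xs , comparable , increasing , bound , tree =
    [ (λ (θ , h) → descending
        (halving-superinc (sub θ xs) (positive-sub θ)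
          (λ lt → subst₂ (λ x y → x + x ≤ y) (sym (lookup-sub θ xs _)) (sym (lookup-sub θ xs _)) (h lt)))
        (bound-sub θ) (ordered-sub θ))
    , (λ (θ , h) → ascending
        (doubling-asc (sub θ xs) (positive-sub θ)
          (λ lt → subst₂ (λ x y → x + x ≤ y) (sym (lookup-sub θ xs _)) (sym (lookup-sub θ xs _)) (h lt)))
        (bound-sub θ) (ordered-sub θ)) ]′
    (chain {P = λ i j → lookup xs j + lookup xs j ≤ lookup xs i} {Q = λ i j → lookup xs i + lookup xs i ≤ lookup xs j}
      (λ {i} {j} lt → ⊎-map
        (λ h → subst₂ (λ x y → y + y ≤ x) (sym (lookup-map i width Xs)) (sym (lookup-map j width Xs))
                 (dominates-width {lookup Xs i} {lookup Xs j} h))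
        (λ h → subst₂ (λ x y → x + x ≤ y) (sym (lookup-map i width Xs)) (sym (lookup-map j width Xs))
                 (dominates-width {lookup Xs j} {lookup Xs i} h))
        (allpairs-lookup comparable lt)))
    where
    xs = map width Xs
    x₀ = sum (map (λ X → X zero) Xs)
    value = gridSum-binary Xs increasing
    positive-sub : ∀ {k} (θ : Thin k m) i → 0 < lookup (sub θ xs) i
    positive-sub θ i = subst (0 <_) (sym (trans (lookup-sub θ xs i) (lookup-map (at θ i) width Xs)))
      (m<n⇒0<n∸m (All.lookup⁺ increasing (at θ i) zero (suc zero) z<s))
    bound-sub : ∀ {k} (θ : Thin k m) → x₀ + sum (sub θ xs) < M
    bound-sub θ = ≤-<-trans
      (≤-trans (+-monoʳ-≤ x₀ (sum-sub θ xs)) (≤-reflexive (trans (cong (x₀ +_) (sym (dot-ones xs))) (value _)))) (bound _)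
    ordered-sub : ∀ {k} (θ : Thin k m) → Ordered _≺_ (replicate k free) (λ v → x₀ + dot (sub θ xs) v)
    ordered-sub θ = ordered-map
      (λ u v → subst₂ _≺_ (sym (trans (cong (x₀ +_) (dot-sub θ xs u)) (value _)))
                          (sym (trans (cong (x₀ +_) (dot-sub θ xs v)) (value _))))
      (ordered-spread θ (λ i → lookup-replicate (at θ i) free) (gridtree-binary tree))

-- The first bit where the words differ decides both the sum and the value; superincrease excludes a
-- sum that goes the other way.
superinc-< : ∀ {R : B → B → Set} {xs : Vec ℕ n} {f} b → SuperInc xs → Ordered R (replicate n (sign b)) f →
             ∀ u v → dot xs u < dot xs v → Edge R (sign b) (f u) (f v)
superinc-< b [] o [] [] ()
superinc-< b (_ ∷ si) (node _ l r) (false ∷ u) (false ∷ v) lt = superinc-< b si l u v lt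
superinc-< b (_∷_ {x = x} _ si) (node _ l r) (true ∷ u) (true ∷ v) lt =
  superinc-< b si r u v (+-cancelˡ-< x _ _ lt)
superinc-< b si (node p l r) (false ∷ u) (true ∷ v) lt = edge-map (sign b) (λ q → q u v) (λ q → q v u) p
superinc-< b (_∷_ {x = x} {xs} h _) _ (true ∷ u) (false ∷ v) lt =
  ⊥-elim (<-irrefl refl (<-trans lt (≤-<-trans (dot≤sum xs v) (<-≤-trans h (m≤m+n x (dot xs u))))))

-- Gives properness of the cube: the first differing bit outweighs all later ones.
superinc-injective : {xs : Vec ℕ n} → SuperInc xs → ∀ u v → dot xs u ≡ dot xs v → u ≡ v
superinc-injective _ [] [] _ = refl
superinc-injective (_ ∷ si) (false ∷ u) (false ∷ v) eq = cong (false ∷_) (superinc-injective si u v eq)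
superinc-injective (_∷_ {x = x} _ si) (true ∷ u) (true ∷ v) eq =
  cong (true ∷_) (superinc-injective si u v (+-cancelˡ-≡ x _ _ eq))
superinc-injective (_∷_ {x = x} {xs} h _) (true ∷ u) (false ∷ v) eq =
  ⊥-elim (<-irrefl (sym eq) (≤-<-trans (dot≤sum xs v) (<-≤-trans h (m≤m+n x (dot xs u)))))
superinc-injective (_∷_ {x = x} {xs} h _) (false ∷ u) (true ∷ v) eq =
  ⊥-elim (<-irrefl eq (≤-<-trans (dot≤sum xs u) (<-≤-trans h (m≤m+n x (dot xs v)))))

-- Transfer to integers and to the given sequence

sumFin-dot : (xs : Vec ℕ d) (ε : Fin d → Bool) →
             sumFin (λ i → bit (ε i) ℤ.* (ℤ.+ lookup xs i)) ≡ ℤ.+ dot xs (tabulate ε)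
sumFin-dot [] ε = refl
sumFin-dot (x ∷ xs) ε = cong₂ ℤ._+_ (term (ε zero)) (sumFin-dot xs (ε ∘ suc))
  where
  term : ∀ b → bit b ℤ.* (ℤ.+ x) ≡ ℤ.+ (if b then x else 0)
  term false = refl
  term true = ℤ.*-identityˡ (ℤ.+ x)

-- Ties are broken by the index, which gives a linear order on all of ℕ; only 1, …, m is tie free.
module _ (O : StrictTotalOrder 0ℓ 0ℓ 0ℓ) (a : ℤ → StrictTotalOrder.Carrier O) where
  private module O = StrictTotalOrder O

  infix 4 _≺_
  _≺_ : ℕ → ℕ → Set
  i ≺ j = (a (ℤ.+ suc i) O.< a (ℤ.+ suc j)) ⊎ (a (ℤ.+ suc i) O.≈ a (ℤ.+ suc j) × i < j)

  ≺-linear : Linear _≺_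
  ≺-linear = tr , cmp
    where
    tr : Transitive _≺_
    tr (inj₁ p) (inj₁ q) = inj₁ (O.trans p q)
    tr (inj₁ p) (inj₂ (e , _)) = inj₁ (O.<-respʳ-≈ e p)
    tr (inj₂ (e , _)) (inj₁ q) = inj₁ (O.<-respˡ-≈ (O.Eq.sym e) q)
    tr (inj₂ (e , p)) (inj₂ (e′ , q)) = inj₂ (O.Eq.trans e e′ , <-trans p q)
    cmp : Trichotomous _≡_ _≺_
    cmp i j with O.compare (a (ℤ.+ suc i)) (a (ℤ.+ suc j))
    ... | tri< p ¬e ¬q = tri< (inj₁ p) (λ { refl → ¬e O.Eq.refl }) [ ¬q , ¬e ∘ O.Eq.sym ∘ proj₁ ]′
    ... | tri> ¬p ¬e q = tri> [ ¬p , ¬e ∘ proj₁ ]′ (λ { refl → ¬e O.Eq.refl }) (inj₁ q)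
    ... | tri≈ ¬p e ¬q with <-cmp i j
    ...   | tri< p ¬e ¬r = tri< (inj₂ (e , p)) ¬e [ ¬q , ¬r ∘ proj₂ ]′
    ...   | tri≈ ¬r e′ ¬s = tri≈ [ ¬p , ¬r ∘ proj₂ ]′ e′ [ ¬q , ¬s ∘ proj₂ ]′
    ...   | tri> ¬r ¬e s = tri> [ ¬p , ¬r ∘ proj₂ ]′ ¬e (inj₂ (O.Eq.sym e , s))

  -- A tie would identify two different indices in the range where the values are distinct.
  ≺⇒< : ∀ {M} → DistinctOn O M a → ∀ {i j} → i < M → j < M → i ≺ j → a (ℤ.+ suc i) O.< a (ℤ.+ suc j)
  ≺⇒< _ _ _ (inj₁ p) = p
  ≺⇒< distinct i<M j<M (inj₂ (e , i<j)) =
    ⊥-elim (<-irrefl (suc-injective (ℤ.+-injective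
      (distinct _ _ (ℤ.+≤+ (s≤s z≤n)) (ℤ.+≤+ i<M) (ℤ.+≤+ (s≤s z≤n)) (ℤ.+≤+ j<M) e))) i<j)

  realise : ∀ {d M} → DistinctOn O M a → MonotoneCube d M _≺_ →
    Σ ℤ λ x₀ → Σ (Fin d → ℤ) λ x →
      ProperCube x₀ x × CubeIn M x₀ x × (IncreasingOn O a x₀ x ⊎ DecreasingOn O a x₀ x)
  realise {d} {M} distinct (x₀ , xs , si , bound , b , o) =
    -- A natural number `i` below `M` stands for the index `suc i`, hence the shifted base.
    ℤ.+ suc x₀ , x , proper ,
    (λ ε → subst (λ z → ℤ.1ℤ ℤ.≤ z × z ℤ.≤ ℤ.+ M) (sym (elem ε))
             (ℤ.+≤+ (s≤s z≤n) , ℤ.+≤+ (idx<M ε))) ,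
    monotone b o
    where
    x : Fin d → ℤ
    x i = ℤ.+ lookup xs i
    idx : (Fin d → Bool) → ℕ
    idx ε = x₀ + dot xs (tabulate ε)
    elem : ∀ ε → cubeElem (ℤ.+ suc x₀) x ε ≡ ℤ.+ suc (idx ε)
    elem ε = cong (ℤ._+_ (ℤ.+ suc x₀)) (sumFin-dot xs ε)
    idx<M : ∀ ε → idx ε < M
    idx<M ε = ≤-<-trans (+-monoʳ-≤ x₀ (dot≤sum xs _)) bound

    proper : ProperCube (ℤ.+ suc x₀) x
    proper ε ε′ eq i = trans (sym (lookup∘tabulate ε i)) (trans (cong (λ v → lookup v i)
      (superinc-injective si _ _ (+-cancelˡ-≡ x₀ _ _
        (suc-injective (ℤ.+-injective (trans (sym (elem ε)) (trans eq (elem ε′)))))))) (lookup∘tabulate ε′ i))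

    dot< : ∀ ε ε′ → cubeElem (ℤ.+ suc x₀) x ε ℤ.< cubeElem (ℤ.+ suc x₀) x ε′ →
           dot xs (tabulate ε) < dot xs (tabulate ε′)
    dot< ε ε′ lt = +-cancelˡ-< x₀ _ _ (≤-pred (ℤ.drop‿+<+ (subst₂ ℤ._<_ (elem ε) (elem ε′) lt)))

    to-O : ∀ ε ε′ → idx ε ≺ idx ε′ → a (cubeElem (ℤ.+ suc x₀) x ε) O.< a (cubeElem (ℤ.+ suc x₀) x ε′)
    to-O ε ε′ p = subst₂ (λ i j → a i O.< a j) (sym (elem ε)) (sym (elem ε′)) (≺⇒< distinct (idx<M ε) (idx<M ε′) p)

    monotone : ∀ b → Ordered _≺_ (replicate d (sign b)) (λ v → x₀ + dot xs v) →
               IncreasingOn O a (ℤ.+ suc x₀) x ⊎ DecreasingOn O a (ℤ.+ suc x₀) x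
    monotone true o = inj₁ λ ε ε′ lt → to-O ε ε′ (superinc-< true si o _ _ (dot< ε ε′ lt))
    monotone false o = inj₂ λ ε ε′ lt → to-O ε′ ε (superinc-< false si o _ _ (dot< ε ε′ lt))

theorem1 : (d : ℕ) → 1 ≤ d →
    Σ ℕ λ m → 1 ≤ m ×
    ((O : StrictTotalOrder 0ℓ 0ℓ 0ℓ) → (a : ℤ → StrictTotalOrder.Carrier O) →
    DistinctOn O m a →
    Σ ℤ λ x₀ → Σ (Fin d → ℤ) λ x →
    ProperCube x₀ x × CubeIn m x₀ x × (IncreasingOn O a x₀ x ⊎ DecreasingOn O a x₀ x))
theorem1 d _ =
  let M , cube = monotone-cube d
  -- Positivity is read off the cube that exists for the usual order on ℕ, as its largest index is
  -- less than `M`.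
  in M , positive (cube <-linear) , λ O a distinct → realise O a distinct (cube (≺-linear O a))
  where
  <-linear : Linear _<_
  <-linear = <-trans , <-cmp
  positive : ∀ {_≺_} → MonotoneCube d (proj₁ (monotone-cube d)) _≺_ → 1 ≤ proj₁ (monotone-cube d)
  positive (_ , _ , _ , bound , _) = ≤-<-trans z≤n bound
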